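{- Let $\mathcal{F}$ be an essentially finite class of simple graphs. Then there exists a finite graph class $\mathcal{F}'$ such that $G\equiv_{\mathcal{F}}H$ if and only if $G\equiv_{\mathcal{F}'}H$ for all graphs $G$ and $H$. In particular, there is a polynomial-time algorithm that decides, given two graphs $G$ and $H$, whether $G\equiv_{\mathcal{F}}H$.
   Context: All graphs are finite, undirected, without multiple edges; simple means without loops. $\hom(F,G)$ counts homomorphisms; $G\equiv_{\mathcal{F}}H$ means $\hom(F,G)=\hom(F,H)$ for all $F\in\mathcal{F}$. $\Gamma(\mathcal{F})$ is the set of isomorphism types of connected components of graphs in $\mathcal{F}$; $\mathcal{F}$ is essentially finite if $\Gamma(\mathcal{F})$ is finite. -}

module Defs where

open import Data.Bool.Base using (Bool; true; false)
open import Data.Bool.Properties using () renaming (_≟_ to _≟ᵇ_)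
open import Data.Fin.Base using (Fin; finToFun)
open import Data.Fin.Properties using (all?)
open import Data.List.Base using (List; []; _∷_; _++_; length; filter; replicate; concatMap; map; allFin; foldr)
open import Data.List.Relation.Unary.Any using (Any)
open import Data.Maybe.Base using (Maybe; just; nothing)
open import Data.Nat.Base using (ℕ; zero; suc; _+_; _*_; _^_)
open import Data.Product.Base using (Σ-syntax; ∃-syntax; _×_; _,_)
open import Data.Vec.Base as Vec using (Vec)
open import Function.Base using (_∘_)
open import Function.Bundles using (_↔_; _⇔_; Inverse)
open import Function.Definitions using (Injective)
open import Level using (Level; 0ℓ)
open import Relation.Binary.Construct.Closure.ReflexiveTransitive using (Star)
open import Relation.Binary.Core using (Rel)
open import Relation.Binary.PropositionalEquality using (_≡_)
open import Relation.Nullary.Decidable using (Dec; _→-dec_)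
open import Relation.Nullary.Reflects using (Reflects)
open import Relation.Unary using (Pred)

private
  variable
    ℓ : Level

-- Loops are allowed; an edge uv is recorded as adj u v ≡ adj v u ≡ true.
record Graph : Set where
  field
    order   : ℕ
    adj     : Fin order → Fin order → Bool
    adj-sym : ∀ u v → adj u v ≡ adj v u

  Vertex : Set
  Vertex = Fin order

  Adj : Rel Vertex 0ℓ
  Adj u v = adj u v ≡ true

open Graph public using (order; adj; adj-sym; Vertex; Adj)

Simple : Graph → Set
Simple G = ∀ v → adj G v v ≡ false

infix 4 _≅_
_≅_ : Rel Graph 0ℓ
G ≅ H = Σ[ φ ∈ (Vertex G ↔ Vertex H) ]
          (∀ u v → adj G u v ≡ adj H (Inverse.to φ u) (Inverse.to φ v))

IsHom : (F G : Graph) → (Vertex F → Vertex G) → Set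
IsHom F G f = ∀ u v → Adj F u v → Adj G (f u) (f v)

isHom? : ∀ F G f → Dec (IsHom F G f)
isHom? F G f = all? λ u → all? λ v →
  (adj F u v ≟ᵇ true) →-dec (adj G (f u) (f v) ≟ᵇ true)

-- finToFun enumerates every map Vertex F → Vertex G exactly once.
hom : Graph → Graph → ℕ
hom F G = length (filter (isHom? F G ∘ finToFun) (allFin (order G ^ order F)))

infix 4 _≡[_]_
_≡[_]_ : Graph → Pred Graph ℓ → Graph → Set ℓ
G ≡[ 𝓕 ] H = ∀ {F} → 𝓕 F → hom F G ≡ hom F H

-- C is isomorphic to a connected component of F: e embeds C as the induced
-- subgraph on the set of all vertices reachable from some root.
IsComponentOf : Graph → Graph → Set
IsComponentOf C F =
  Σ[ e ∈ (Vertex C → Vertex F) ]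
    Injective _≡_ _≡_ e
    × (∀ u v → adj C u v ≡ adj F (e u) (e v))
    × ∃[ root ] (∀ w → (∃[ u ] e u ≡ w) ⇔ Star (Adj F) root w)

Γ : Pred Graph ℓ → Pred Graph ℓ
Γ 𝓕 C = ∃[ F ] 𝓕 F × IsComponentOf C F

-- A class is finite when it has finitely many members up to isomorphism.
Finite : Pred Graph ℓ → Set ℓ
Finite 𝓒 = Σ[ Gs ∈ List Graph ] (∀ {C} → 𝓒 C → Any (C ≅_) Gs)

EssentiallyFinite : Pred Graph ℓ → Set ℓ
EssentiallyFinite 𝓕 = Finite (Γ 𝓕)

-- Deterministic multi-tape Turing machines with tape alphabet {0, 1, blank};
-- nothing is the blank.
Symbol : Set
Symbol = Maybe Bool

data Move : Set where
  left stay right : Move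

-- A two-way infinite tape. Both lists start next to the head, and all cells
-- beyond their ends are blank.
record Tape : Set where
  constructor tape
  field
    before : List Symbol
    head   : Symbol
    after  : List Symbol

open Tape public

blankTape : Tape
blankTape = tape [] nothing []

inputTape : List Bool → Tape
inputTape []       = blankTape
inputTape (b ∷ bs) = tape [] (just b) (map just bs)

move : Move → Tape → Tape
move stay  t                   = t
move left  (tape []       s r) = tape [] nothing (s ∷ r)
move left  (tape (x ∷ l)  s r) = tape l x (s ∷ r)
move right (tape l s [])       = tape (s ∷ l) nothing []
move right (tape l s (x ∷ r))  = tape (s ∷ l) x r

act : Symbol × Move → Tape → Tape
act (s , m) (tape l _ r) = move m (tape l s r)

-- The input is on the first tape; workTapes counts the others. The machine
-- halts on entering a state q with verdict q ≡ just b, accepting iff b ≡ true.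
record TuringMachine : Set where
  field
    workTapes : ℕ
    states    : ℕ
    start     : Fin states
    verdict   : Fin states → Maybe Bool
    δ         : Fin states → Vec Symbol (suc workTapes) →
                Fin states × Vec (Symbol × Move) (suc workTapes)

  Config : Set
  Config = Fin states × Vec Tape (suc workTapes)

  initial : List Bool → Config
  initial w = start , inputTape w Vec.∷ Vec.replicate workTapes blankTape

  step : Config → Config
  step (q , ts) with δ q (Vec.map head ts)
  ... | q′ , as = q′ , Vec.zipWith act as ts

  -- The verdict, if the machine halts within the given number of steps.
  runWithin : ℕ → Config → Maybe Bool
  runWithin t (q , ts) with verdict q
  runWithin t       (q , ts) | just b  = just b
  runWithin zero    (q , ts) | nothing = nothing
  runWithin (suc t) (q , ts) | nothing = runWithin t (step (q , ts))

open TuringMachine public using (initial; runWithin)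

-- Polynomials with coefficients in ℕ, constant term first.
evalPoly : List ℕ → ℕ → ℕ
evalPoly p x = foldr (λ a r → a + x * r) 0 p

-- The order in unary, a 0, and then the adjacency matrix row by row.
encode : Graph → List Bool
encode G = replicate (order G) true ++ false ∷
  concatMap (λ u → map (adj G u) (allFin (order G))) (allFin (order G))

encodePair : Graph → Graph → List Bool
encodePair G H = encode G ++ encode H

PolyTimeDecidable : Rel Graph ℓ → Set ℓ
PolyTimeDecidable R =
  Σ[ M ∈ TuringMachine ] Σ[ p ∈ List ℕ ] (∀ G H →
    let w = encodePair G H in
    ∃[ b ] runWithin M (evalPoly p (length w)) (initial M w) ≡ just b
           × Reflects (R G H) b)

{-# OPTIONS --safe #-}

-- A homomorphism count factorises over the connected components, so if these have finitely many
-- isomorphism types C₁, …, Cₘ, then hom(F, G) = ∏ hom(Cᵢ, G)^aᵢ for an exponent vector a that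
-- depends only on F. For fixed sets of vanishing hom(Cᵢ, G) and hom(Cᵢ, H), either some F separates
-- all such pairs G, H, or the vectors a on which G and H agree are those of a saturated subgroup of
-- ℤᵐ, and Gaussian elimination extracts finitely many vectors that imply all the others. Running
-- over all pairs of vanishing sets gives a finite subclass. For the algorithm, a Turing machine counts the
-- homomorphisms from a fixed graph by nested loops over unary counters.

module Submission where

open import Defs
open import Axiom.ExcludedMiddle using (ExcludedMiddle)
open import Data.Bool.Base using (Bool; true; false; if_then_else_; _∨_)
open import Data.Bool.Properties using () renaming (_≟_ to _≟ᵇ_)
open import Data.Fin.Base as Fin
  using (Fin; zero; suc; _↑ʳ_; toℕ; fromℕ; inject₁; inject≤; finToFun; funToFin; splitAt; join)
open import Data.Fin.Properties as Fin
  using (injective⇒≤; finToFun-funToFin; funToFin-finToFin; inject≤-injective; splitAt-join; toℕ-fromℕ;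
    toℕ-inject₁; toℕ-injective; toℕ<n)
open import Data.Integer.Base as ℤ using (ℤ; +_; -[1+_]; 0ℤ)
open import Data.Integer.Properties as ℤ using (pos-*; pos-+)
open import Data.Integer.Tactic.RingSolver using (solve-∀)
open import Data.List.Base as List
  using (List; []; _∷_; _++_; length; map; filter; allFin; concatMap; downFrom; cartesianProduct;
    cartesianProductWith)
open import Data.List.Membership.Propositional using (_∈_)
open import Data.List.Membership.Propositional.Properties
  using (∈-allFin; ∈-cartesianProduct⁺; ∈-cartesianProduct⁻; ∈-cartesianProductWith⁺; ∈-downFrom⁺;
    ∈-filter⁺; ∈-filter⁻; ∈-lookup; ∈-map⁻)
open import Data.List.Properties
  using (++-assoc; ++-identityʳ; filter-++; length-++; length-filter; length-map; length-replicate;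
    length-tabulate; map-∘; map-cong)
open import Data.List.Relation.Unary.All as All using (All; []; _∷_)
open import Data.List.Relation.Unary.All.Properties as All using ()
open import Data.List.Relation.Unary.AllPairs using ([]; _∷_)
open import Data.List.Relation.Unary.Any as Any using (Any; here; there; index)
open import Data.List.Relation.Unary.Unique.Propositional using (Unique)
open import Data.List.Relation.Unary.Unique.Propositional.Properties as Unique
  using (allFin⁺; cartesianProductWith⁺; downFrom⁺)
open import Data.Maybe.Base as Maybe using (Maybe; just; nothing; is-just; maybe)
open import Data.Nat.Base using (ℕ; zero; suc; _+_; _*_; _∸_; _^_; _≤_; _<_; z≤n; s≤s; NonZero; ≢-nonZero⁻¹)
open import Data.Nat.ListAction using (sum)
open import Data.Nat.Properties as ℕ using ()
open import Data.Nat.Tactic.RingSolver using () renaming (solve-∀ to solveℕ-∀)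
open import Data.Product.Base as Product using (Σ-syntax; ∃-syntax; _×_; _,_; proj₁; proj₂)
open import Data.Sum.Base as Sum using (_⊎_; inj₁; inj₂; [_,_]′)
open import Data.Sum.Properties using (inj₁-injective; inj₂-injective)
open import Data.Unit.Base using (⊤; tt)
open import Data.Vec.Base as Vec using (Vec; []; _∷_; lookup; replicate; tabulate; zipWith; fromList; _[_]≔_)
open import Data.Vec.Properties as Vec
  using ([]≔-lookup; lookup-map; lookup-replicate; lookup-zipWith; lookup∘tabulate; lookup∘update;
    lookup∘update′; ∷-injective)
open import Data.Vec.Relation.Unary.All as VAll using ([]; _∷_)
open import Function.Base using (_∘_; id; case_of_)
open import Function.Bundles using (_⇔_; mk⇔; Equivalence; Inverse)
open import Function.Definitions using (Injective)
open import Level using (Level; 0ℓ; Lift; lift; lower)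
open import Relation.Binary.Construct.Closure.ReflexiveTransitive using (Star; ε; _◅_; _◅◅_; gmap)
open import Relation.Binary.Definitions using (tri<; tri≈; tri>)
open import Relation.Binary.PropositionalEquality
open import Relation.Nullary.Decidable using (Dec; yes; no; does; map′)
open import Relation.Nullary.Negation using (contradiction)
open import Relation.Nullary.Reflects using (Reflects; ofʸ; ofⁿ)
open import Relation.Unary using (Pred)
open import Algebra.Properties.CommutativeSemigroup ℕ.*-commutativeSemigroup
  using () renaming (interchange to *-interchange; x∙yz≈y∙xz to *-swap)

-- Where no count vanishes, G and H agree on ∏ hom(Cᵢ, -)^aᵢ exactly when ∏ (gᵢ/hᵢ)^aᵢ = 1, with gᵢ
-- = hom(Cᵢ, G) and hᵢ = hom(Cᵢ, H). This makes sense for integer exponents, whose solutions form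
-- the kernel of a homomorphism from ℤᵐ to the positive rationals. The passage to ℤ matters: the
-- exponents occurring in `𝓕` may generate a submonoid of ℕᵐ that is not finitely generated.
-- Positive rationals have no torsion, so the kernel is saturated, and elimination can multiply by
-- pivots and divide at the end. Zero counts cannot be inverted; hence the split into the 4ᵐ pairs
-- of vanishing patterns.
--
-- Two demands shape the statements. The basis is fixed before G and H, so it has to span within
-- every saturated subgroup at once. And it consists of exponents of members of `𝓕`, since a single
-- component may separate graphs that `𝓕` does not. As `𝓕` is an arbitrary predicate, pivots are
-- chosen by excluded middle.
--
-- For the algorithm the list of graphs is fixed: loops have constant depth, and hom(F, G) ≤ |G|^|F|
-- keeps unary counters polynomial.

private
  variable
    ℓ : Level
    A B : Set
    m T : ℕ

-- Homomorphism counts and connected components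

length-cartesianProduct : (xs : List A) (ys : List B) → length (cartesianProduct xs ys) ≡ length xs * length ys
length-cartesianProduct [] ys = refl
length-cartesianProduct (x ∷ xs) ys = trans (length-++ (List.map (x ,_) ys))
  (cong₂ _+_ (length-map (x ,_) ys) (length-cartesianProduct xs ys))

index-injective : ∀ {x y : A} {xs} (p : x ∈ xs) (q : y ∈ xs) → index p ≡ index q → x ≡ y
index-injective (here refl) (here refl) _ = refl
index-injective (there p) (there q) eq = index-injective p q (Fin.suc-injective eq)

lookup-injective : ∀ {xs : List A} → Unique xs → ∀ i j → List.lookup xs i ≡ List.lookup xs j → i ≡ j
lookup-injective (_ ∷ _) zero zero _ = refl
lookup-injective (x∉ ∷ _) zero (suc j) eq = contradiction eq (All.lookup x∉ (∈-lookup j))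
lookup-injective (x∉ ∷ _) (suc i) zero eq = contradiction (sym eq) (All.lookup x∉ (∈-lookup i))
lookup-injective (_ ∷ u) (suc i) (suc j) eq = cong suc (lookup-injective u i j eq)

-- Pigeonhole on list positions. Each identity of `hom` with another count below comes from two such
-- injections, so that no map has to be matched with an inverse.
length-inject : ∀ {xs : List A} {ys : List B} → Unique xs → (f : A → B) →
  (∀ {x} → x ∈ xs → f x ∈ ys) →
  (∀ {x y} → x ∈ xs → y ∈ xs → f x ≡ f y → x ≡ y) → length xs ≤ length ys
length-inject {xs = xs} u f f∈ f-inj = injective⇒≤ {f = λ i → index (f∈ (∈-lookup {xs = xs} i))} λ {i} {j} eq →
  lookup-injective u i j (f-inj (∈-lookup i) (∈-lookup j) (index-injective (f∈ (∈-lookup i)) (f∈ (∈-lookup j)) eq))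

funToFin-cong : ∀ {m n} {f g : Fin m → Fin n} → f ≗ g → funToFin f ≡ funToFin g
funToFin-cong {zero} _ = refl
funToFin-cong {suc m} f≗g = cong₂ Fin.combine (f≗g zero) (funToFin-cong (f≗g ∘ suc))

funToFin-injective : ∀ {m n} {f g : Fin m → Fin n} → funToFin f ≡ funToFin g → f ≗ g
funToFin-injective {f = f} {g} eq u =
  trans (sym (finToFun-funToFin f u)) (trans (cong (λ c → finToFun c u) eq) (finToFun-funToFin g u))

finToFun-injective : ∀ {m n} (c d : Fin (n ^ m)) → finToFun {n} {m} c ≗ finToFun d → c ≡ d
finToFun-injective {m} {n} c d eq =
  trans (sym (funToFin-finToFin {m} {n} c)) (trans (funToFin-cong eq) (funToFin-finToFin {m} {n} d))

IsHom-resp-≗ : ∀ F G {f g : Vertex F → Vertex G} → f ≗ g → IsHom F G f → IsHom F G g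
IsHom-resp-≗ F G f≗g f-hom u v uv = trans (sym (cong₂ (adj G) (f≗g u) (f≗g v))) (f-hom u v uv)

homs : ∀ F G → List (Fin (order G ^ order F))
homs F G = filter (isHom? F G ∘ finToFun) (allFin (order G ^ order F))

homs-unique : ∀ F G → Unique (homs F G)
homs-unique F G = Unique.filter⁺ _ (allFin⁺ _)

homs-complete : ∀ F G {f} → IsHom F G f → funToFin f ∈ homs F G
homs-complete F G {f} f-hom = ∈-filter⁺ (isHom? F G ∘ finToFun) (∈-allFin _)
  (IsHom-resp-≗ F G (sym ∘ finToFun-funToFin f) f-hom)

homs-sound : ∀ F G {c} → c ∈ homs F G → IsHom F G (finToFun c)
homs-sound F G c∈ = proj₂ (∈-filter⁻ (isHom? F G ∘ finToFun) {xs = allFin (order G ^ order F)} c∈)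

-- Maps are compared by `≗`, as function extensionality is not at hand; `finToFun-injective` turns
-- pointwise equality back into equality of codes.
hom≤length : ∀ F G {ys : List A} (Φ : (Vertex F → Vertex G) → A) →
  (∀ {f} → IsHom F G f → Φ f ∈ ys) → (∀ {f g} → Φ f ≡ Φ g → f ≗ g) → hom F G ≤ length ys
hom≤length F G Φ Φ∈ Φ-inj = length-inject (homs-unique F G) (Φ ∘ finToFun)
  (Φ∈ ∘ homs-sound F G) (λ {c} {d} _ _ → finToFun-injective c d ∘ Φ-inj)

length≤hom : ∀ F G {xs : List A} → Unique xs → (Ψ : A → (Vertex F → Vertex G)) →
  (∀ {x} → x ∈ xs → IsHom F G (Ψ x)) →
  (∀ {x y} → x ∈ xs → y ∈ xs → Ψ x ≗ Ψ y → x ≡ y) → length xs ≤ hom F G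
length≤hom F G u Ψ Ψ-hom Ψ-inj = length-inject u (funToFin ∘ Ψ)
  (homs-complete F G ∘ Ψ-hom) (λ x∈ y∈ → Ψ-inj x∈ y∈ ∘ funToFin-injective)

≅-sym : ∀ {F F′} → F ≅ F′ → F′ ≅ F
≅-sym {F} {F′} (φ , φ-adj) = record
  { to = from ; from = to ; to-cong = cong from ; from-cong = cong to
  ; inverse = (λ { refl → strictlyInverseʳ _ }) , (λ { refl → strictlyInverseˡ _ }) } ,
  λ u v → trans (cong₂ (adj F′) (sym (strictlyInverseˡ u)) (sym (strictlyInverseˡ v))) (sym (φ-adj _ _))
  where open Inverse φ

≅-refl : ∀ {F} → F ≅ F
≅-refl = record
  { to = λ u → u ; from = λ u → u ; to-cong = λ e → e ; from-cong = λ e → e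
  ; inverse = (λ e → e) , (λ e → e) } , λ _ _ → refl

hom-≅-≤ : ∀ {F F′} → F ≅ F′ → ∀ G → hom F G ≤ hom F′ G
hom-≅-≤ {F} {F′} (φ , φ-adj) G = hom≤length F G {ys = homs F′ G} (λ f → funToFin (f ∘ from))
  (λ {f} f-hom → homs-complete F′ G λ u v uv → f-hom _ _
     (trans (φ-adj _ _) (trans (cong₂ (adj F′) (strictlyInverseˡ u) (strictlyInverseˡ v)) uv)))
  (λ {f} {g} eq u → subst (λ w → f w ≡ g w) (strictlyInverseʳ u) (funToFin-injective eq (to u)))
  where open Inverse φ

hom-≅ : ∀ {F F′} → F ≅ F′ → ∀ G → hom F G ≡ hom F′ G
hom-≅ {F} {F′} F≅F′ G = ℕ.≤-antisym (hom-≅-≤ {F} {F′} F≅F′ G) (hom-≅-≤ {F′} {F} (≅-sym {F} {F′} F≅F′) G)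

-- Splitting a graph along a vertex set that no edge leaves

record Partition {n} (R : Fin n → Bool) : Set where
  field
    {a b}  : ℕ
    sizes  : a + b ≡ n
    e₁     : Fin a → Fin n
    e₂     : Fin b → Fin n
    part   : Fin n → Fin a ⊎ Fin b
    join-part : ∀ v → [ e₁ , e₂ ]′ (part v) ≡ v
    part₁  : ∀ u → part (e₁ u) ≡ inj₁ u
    part₂  : ∀ u → part (e₂ u) ≡ inj₂ u
    R₁     : ∀ u → R (e₁ u) ≡ true
    R₂     : ∀ u → R (e₂ u) ≡ false

partition : ∀ {n} (R : Fin n → Bool) → Partition R
partition {zero} R = record
  { a = 0 ; b = 0 ; sizes = refl ; e₁ = λ () ; e₂ = λ () ; part = λ () ; join-part = λ ()
  ; part₁ = λ () ; part₂ = λ () ; R₁ = λ () ; R₂ = λ () }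
partition {suc n} R with partition (R ∘ suc) | R zero in R0
... | P | true = record
  { sizes = cong suc sizes
  ; e₁ = Fin.lift 1 e₁
  ; e₂ = suc ∘ e₂
  ; part = λ { zero → inj₁ zero ; (suc v) → Sum.map₁ suc (part v) }
  ; join-part = λ { zero → refl ; (suc v) → joined v }
  ; part₁ = λ { zero → refl ; (suc u) → cong (Sum.map₁ suc) (part₁ u) }
  ; part₂ = λ u → cong (Sum.map₁ suc) (part₂ u)
  ; R₁ = λ { zero → R0 ; (suc u) → R₁ u }
  ; R₂ = R₂ }
  where
  open Partition P
  joined : ∀ v → [ Fin.lift 1 e₁ , suc ∘ e₂ ]′ (Sum.map₁ suc (part v)) ≡ suc v
  joined v with part v | join-part v
  ... | inj₁ _ | eq = cong suc eq
  ... | inj₂ _ | eq = cong suc eq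
... | P | false = record
  { sizes = trans (ℕ.+-suc a b) (cong suc sizes)
  ; e₁ = suc ∘ e₁
  ; e₂ = Fin.lift 1 e₂
  ; part = λ { zero → inj₂ zero ; (suc v) → Sum.map₂ suc (part v) }
  ; join-part = λ { zero → refl ; (suc v) → joined v }
  ; part₁ = λ u → cong (Sum.map₂ suc) (part₁ u)
  ; part₂ = λ { zero → refl ; (suc u) → cong (Sum.map₂ suc) (part₂ u) }
  ; R₁ = R₁
  ; R₂ = λ { zero → R0 ; (suc u) → R₂ u } }
  where
  open Partition P
  joined : ∀ v → [ suc ∘ e₁ , Fin.lift 1 e₂ ]′ (Sum.map₂ suc (part v)) ≡ suc v
  joined v with part v | join-part v
  ... | inj₁ _ | eq = cong suc eq
  ... | inj₂ _ | eq = cong suc eq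

pullback : (F : Graph) → ∀ {n} → (Fin n → Vertex F) → Graph
pullback F e = record { order = _ ; adj = λ u v → adj F (e u) (e v) ; adj-sym = λ u v → adj-sym F _ _ }

module _ (F : Graph) (R : Vertex F → Bool) (closed : ∀ u v → Adj F u v → R u ≡ R v) where
  open Partition (partition R)

  inside outside : Graph
  inside = pullback F e₁
  outside = pullback F e₂

  -- By `closed` no edge joins the two sides, so any homomorphism of one side can be glued to any
  -- homomorphism of the other.
  hom-disjoint : ∀ G → hom F G ≡ hom inside G * hom outside G
  hom-disjoint G = trans (ℕ.≤-antisym
    (hom≤length F G {ys = pairs} (λ f → funToFin (f ∘ e₁) , funToFin (f ∘ e₂))
      (λ {f} f-hom → ∈-cartesianProduct⁺ (homs-complete inside G λ u v → f-hom _ _)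
                                         (homs-complete outside G λ u v → f-hom _ _))
      (λ {f} {g} eq u → agree f g (funToFin-injective (cong proj₁ eq)) (funToFin-injective (cong proj₂ eq)) u))
    (length≤hom F G {xs = pairs} (Unique.cartesianProduct⁺ (homs-unique inside G) (homs-unique outside G)) glue
      (λ p → let p₁ , p₂ = ∈-cartesianProduct⁻ (homs inside G) _ p in
        glue-hom (homs-sound inside G p₁) (homs-sound outside G p₂))
      (λ {x} {y} _ _ eq → cong₂ _,_
        (finToFun-injective _ _ λ u → subst (SameOn x y) (part₁ u) (eq (e₁ u)))
        (finToFun-injective _ _ λ u → subst (SameOn x y) (part₂ u) (eq (e₂ u))))))
    (length-cartesianProduct (homs inside G) (homs outside G))
    where
    pairs = cartesianProduct (homs inside G) (homs outside G)

    glue : Fin (order G ^ a) × Fin (order G ^ b) → Vertex F → Vertex G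
    glue (c , d) v = [ finToFun c , finToFun d ]′ (part v)

    SameOn : (x y : Fin (order G ^ a) × Fin (order G ^ b)) → Fin a ⊎ Fin b → Set
    SameOn (c , d) (c′ , d′) i =
      [ finToFun {order G} c , finToFun d ]′ i ≡ [ finToFun {order G} c′ , finToFun d′ ]′ i

    agree : ∀ (f g : Vertex F → Vertex G) → f ∘ e₁ ≗ g ∘ e₁ → f ∘ e₂ ≗ g ∘ e₂ → f ≗ g
    agree f g eq₁ eq₂ v with part v | join-part v
    ... | inj₁ u | refl = eq₁ u
    ... | inj₂ u | refl = eq₂ u

    glue-hom : ∀ {c d} → IsHom inside G (finToFun c) → IsHom outside G (finToFun d) → IsHom F G (glue (c , d))
    glue-hom hc hd u v uv with part u | join-part u | part v | join-part v
    ... | inj₁ _ | refl | inj₁ _ | refl = hc _ _ uv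
    ... | inj₂ _ | refl | inj₂ _ | refl = hd _ _ uv
    ... | inj₁ x | refl | inj₂ y | refl = contradiction (trans (sym (R₁ x)) (trans (closed _ _ uv) (R₂ y))) λ ()
    ... | inj₂ x | refl | inj₁ y | refl = contradiction (trans (sym (R₁ y)) (trans (sym (closed _ _ uv)) (R₂ x))) λ ()

  -- A path that starts outside `R` stays outside, so reachability in `F` and in `outside` coincide
  -- there.
  component-outside : ∀ {K} → IsComponentOf K outside → IsComponentOf K F
  component-outside {K} (e , e-inj , e-adj , root , reach) =
    e₂ ∘ e , (λ eq → e-inj (e₂-inj eq)) , e-adj , e₂ root , λ w → mk⇔
      (λ { (u , refl) → gmap e₂ (λ p → p) (Equivalence.to (reach (e u)) (u , refl)) })
      (λ p → let x , e₂x≡w , q = descend root p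
                 u , eu≡x = Equivalence.from (reach x) q
             in u , trans (cong e₂ eu≡x) e₂x≡w)
    where
    e₂-inj : ∀ {x y} → e₂ x ≡ e₂ y → x ≡ y
    e₂-inj {x} {y} eq = inj₂-injective (trans (sym (part₂ x)) (trans (cong part eq) (part₂ y)))

    descend : ∀ x {w} → Star (Adj F) (e₂ x) w → ∃[ y ] e₂ y ≡ w × Star (Adj outside) x y
    descend x ε = x , refl , ε
    descend x (_◅_ {j = v} xv p) with part v | join-part v
    ... | inj₁ y | refl = contradiction (trans (sym (R₁ y)) (trans (sym (closed _ _ xv)) (R₂ x))) λ ()
    ... | inj₂ y | refl = let z , eq , q = descend y p in z , eq , xv ◅ q

  component-inside : ∀ root → (∀ w → R w ≡ true ⇔ Star (Adj F) root w) → IsComponentOf inside F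
  component-inside root reach = e₁ ,
    (λ {x} {y} eq → inj₁-injective (trans (sym (part₁ x)) (trans (cong part eq) (part₁ y)))) ,
    (λ _ _ → refl) , root , λ w → mk⇔
      (λ { (u , refl) → Equivalence.to (reach w) (R₁ u) })
      (λ p → preimage w (Equivalence.from (reach w) p))
    where
    preimage : ∀ w → R w ≡ true → ∃[ u ] e₁ u ≡ w
    preimage w Rw with part w | join-part w
    ... | inj₁ u | eq = u , eq
    ... | inj₂ u | refl = contradiction (trans (sym Rw) (R₂ u)) λ ()

  order-outside : ∀ r → R r ≡ true → order outside < order F
  order-outside r Rr with part r | join-part r
  ... | inj₁ u | _ = subst (b <_) sizes (nonempty u)
    where
    nonempty : ∀ {a} → Fin a → b < a + b
    nonempty {suc a} _ = s≤s (ℕ.m≤n+m b a)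
  ... | inj₂ u | refl = contradiction (trans (sym Rr) (R₂ u)) λ ()

-- Finite bases of exponent vectors

lincomb : ℤ → Vec ℤ m → ℤ → Vec ℤ m → Vec ℤ m
lincomb α a β b = zipWith (λ x y → α ℤ.* x ℤ.+ β ℤ.* y) a b

-- Saturation says that ℤᵐ modulo `L` is torsion-free. It replaces division by a pivot, which
-- integer vectors do not permit.
record SaturatedSubgroup (L : Pred (Vec ℤ m) 0ℓ) : Set where
  field
    closed    : ∀ α β {a b} → L a → L b → L (lincomb α a β b)
    saturated : ∀ k {a} → k ≢ 0ℤ → L (Vec.map (k ℤ.*_) a) → L a

tail-subgroup : {L : Pred (Vec ℤ (suc m)) 0ℓ} → SaturatedSubgroup L → SaturatedSubgroup (L ∘ (0ℤ ∷_))
tail-subgroup {L = L} S = record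
  { closed = λ α β {a} {b} p q → subst (λ z → L (z ∷ lincomb α a β b)) (zeros α β) (closed α β p q)
  ; saturated = λ k {a} k≢0 p → saturated k k≢0 (subst (λ z → L (z ∷ Vec.map (k ℤ.*_) a)) (sym (ℤ.*-zeroʳ k)) p) }
  where
  open SaturatedSubgroup S
  zeros : ∀ α β → α ℤ.* 0ℤ ℤ.+ β ℤ.* 0ℤ ≡ 0ℤ
  zeros = solve-∀

-- Fraction-free row operation. Applied to the full vectors, the same combination has leading
-- coordinate p x - x p = 0, which is left out here.
eliminate : ℤ → Vec ℤ m → ℤ → Vec ℤ m → Vec ℤ m
eliminate p ps x xs = lincomb p xs (ℤ.- x) ps

-- Adding back x times the pivot row undoes the elimination up to the factor `p`, which saturation
-- then removes.
uneliminate : ∀ p (ps : Vec ℤ m) x xs →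
  lincomb (+ 1) (0ℤ ∷ eliminate p ps x xs) x (p ∷ ps) ≡ Vec.map (p ℤ.*_) (x ∷ xs)
uneliminate p ps x xs = cong₂ _∷_ (eq₁ p x) (go ps xs)
  where
  eq₁ : ∀ p x → (+ 1) ℤ.* 0ℤ ℤ.+ x ℤ.* p ≡ p ℤ.* x
  eq₁ = solve-∀
  eq₂ : ∀ p x y z → (+ 1) ℤ.* (p ℤ.* y ℤ.+ (ℤ.- x) ℤ.* z) ℤ.+ x ℤ.* z ≡ p ℤ.* y
  eq₂ = solve-∀
  go : ∀ {m} (ps xs : Vec ℤ m) → lincomb (+ 1) (eliminate p ps x xs) x ps ≡ Vec.map (p ℤ.*_) xs
  go [] [] = refl
  go (z ∷ ps) (y ∷ xs) = cong₂ _∷_ (eq₂ p x y z) (go ps xs)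

-- `L` is quantified only after `basis` is fixed: one list has to serve all pairs of graphs, and
-- each pair brings its own subgroup.
record FiniteBasis (A : Pred (Vec ℤ m) ℓ) : Set (Level.suc 0ℓ Level.⊔ ℓ) where
  field
    basis    : List (Vec ℤ m)
    members  : All A basis
    spanning : ∀ {L} → SaturatedSubgroup L → All L basis → ∀ {a} → A a → L a

finite-basis : ExcludedMiddle ℓ → (A : Pred (Vec ℤ m) ℓ) → FiniteBasis A
finite-basis {m = zero} em A with em {A []}
-- Even in dimension 0 the vector `[]` is listed, because `L []` can only be learned from the basis:
-- `closed` yields members from members.
... | yes A[] = record { basis = [] ∷ [] ; members = A[] ∷ [] ; spanning = λ { _ (p ∷ []) {[]} _ → p } }
... | no ¬A[] = record { basis = [] ; members = [] ; spanning = λ { _ _ {[]} A[] → contradiction A[] ¬A[] } }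
finite-basis {m = suc m} em A with em {∃[ p ] ∃[ ps ] p ≢ 0ℤ × A (p ∷ ps)}
... | no ¬pivot = record
  { basis = List.map (0ℤ ∷_) basis
  ; members = All.map⁺ members
  ; spanning = λ {L} S Ls → λ
    { {x ∷ xs} Axxs → case x ℤ.≟ 0ℤ of λ
      { (yes refl) → spanning (tail-subgroup S) (All.map⁻ Ls) Axxs
      ; (no x≢0) → contradiction (x , xs , x≢0 , Axxs) ¬pivot } } }
  where
  open FiniteBasis (finite-basis em (A ∘ (0ℤ ∷_)))
... | yes (p , ps , p≢0 , App) = record
  { basis = (p ∷ ps) ∷ originals members
  ; members = App ∷ originals-members members
  ; spanning = λ { {L} S (Lpp ∷ Ls) {x ∷ xs} Axxs →
      SaturatedSubgroup.saturated S p p≢0 (subst L (uneliminate p ps x xs)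
        (SaturatedSubgroup.closed S (+ 1) x
          (spanning (tail-subgroup S) (eliminated S Lpp members Ls) (x , xs , Axxs , refl)) Lpp)) } }
  where
  A′ : Pred (Vec ℤ m) _
  A′ b = ∃[ x ] ∃[ xs ] A (x ∷ xs) × b ≡ eliminate p ps x xs
  open FiniteBasis (finite-basis em A′)

  originals : ∀ {bs} → All A′ bs → List (Vec ℤ (suc m))
  originals [] = []
  originals ((x , xs , _) ∷ rest) = (x ∷ xs) ∷ originals rest

  originals-members : ∀ {bs} (As : All A′ bs) → All A (originals As)
  originals-members [] = []
  originals-members ((x , xs , Axxs , _) ∷ rest) = Axxs ∷ originals-members rest

  eliminated : ∀ {L} → SaturatedSubgroup L → L (p ∷ ps) → ∀ {bs} (As : All A′ bs) → All L (originals As) →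
    All (L ∘ (0ℤ ∷_)) bs
  eliminated S Lpp [] [] = []
  eliminated {L} S Lpp ((x , xs , _ , refl) ∷ rest) (Lxxs ∷ Ls) =
    subst (λ z → L (z ∷ eliminate p ps x xs)) (cancel p x) (SaturatedSubgroup.closed S p (ℤ.- x) Lxxs Lpp)
    ∷ eliminated S Lpp rest Ls
    where
    cancel : ∀ p x → p ℤ.* x ℤ.+ (ℤ.- x) ℤ.* p ≡ 0ℤ
    cancel = solve-∀

-- Monomials and the multiplicative relations between two positive vectors

monomial : Vec ℕ m → Vec ℕ m → ℕ
monomial [] [] = 1
monomial (a ∷ as) (g ∷ gs) = g ^ a * monomial as gs

monomial-+ : (u v g : Vec ℕ m) → monomial (zipWith _+_ u v) g ≡ monomial u g * monomial v g
monomial-+ [] [] [] = refl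
monomial-+ (u ∷ us) (v ∷ vs) (g ∷ gs) =
  trans (cong₂ _*_ (ℕ.^-distribˡ-+-* g u v) (monomial-+ us vs gs)) (*-interchange (g ^ u) _ _ _)

^-distribʳ-* : ∀ n x y → (x * y) ^ n ≡ x ^ n * y ^ n
^-distribʳ-* zero x y = refl
^-distribʳ-* (suc n) x y = trans (cong (x * y *_) (^-distribʳ-* n x y)) (*-interchange x y (x ^ n) (y ^ n))

monomial-* : ∀ n (u g : Vec ℕ m) → monomial (Vec.map (n *_) u) g ≡ monomial u g ^ n
monomial-* n [] [] = sym (ℕ.^-zeroˡ n)
monomial-* n (u ∷ us) (g ∷ gs) = trans
  (cong₂ _*_ (trans (cong (g ^_) (ℕ.*-comm n u)) (sym (ℕ.^-*-assoc g u n))) (monomial-* n us gs))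
  (sym (^-distribʳ-* n (g ^ u) _))

monomial-0 : (g : Vec ℕ m) → monomial (replicate m 0) g ≡ 1
monomial-0 [] = refl
monomial-0 (g ∷ gs) = trans (ℕ.+-identityʳ _) (monomial-0 gs)

Positive : Vec ℕ m → Set
Positive = VAll.All NonZero

monomial-nonZero : ∀ {g : Vec ℕ m} → Positive g → ∀ u → NonZero (monomial u g)
monomial-nonZero [] [] = _
monomial-nonZero {g = g ∷ _} (g≢0 ∷ pos) (u ∷ us) =
  ℕ.m*n≢0 _ _ {{ℕ.m^n≢0 g u {{g≢0}}}} {{monomial-nonZero pos us}}

-- Powers are strictly monotone, so roots in ℕ are unique. Saturation of the relations rests on
-- this.
^-cancelʳ-≡ : ∀ k x y → x ^ suc k ≡ y ^ suc k → x ≡ y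
^-cancelʳ-≡ k x y eq with ℕ.<-cmp x y
... | tri< x<y _ _ = contradiction eq (ℕ.<⇒≢ (ℕ.^-monoˡ-< (suc k) x<y))
... | tri≈ _ x≡y _ = x≡y
... | tri> _ _ x>y = contradiction (sym eq) (ℕ.<⇒≢ (ℕ.^-monoˡ-< (suc k) x>y))

-- u − v = a, stated without subtraction.
Difference : Vec ℤ m → Vec ℕ m → Vec ℕ m → Set
Difference [] [] [] = ⊤
Difference (a ∷ as) (u ∷ us) (v ∷ vs) = (a ℤ.+ + v ≡ + u) × Difference as us vs

difference : (a : Vec ℤ m) → ∃[ u ] ∃[ v ] Difference a u v
difference [] = [] , [] , tt
difference (+ n ∷ a) with difference a
... | u , v , d = n ∷ u , 0 ∷ v , ℤ.+-identityʳ (+ n) , d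
difference (-[1+ n ] ∷ a) with difference a
... | u , v , d = 0 ∷ u , suc n ∷ v , ℤ.+-inverseˡ (+ suc n) , d

difference-+ : ∀ (a b : Vec ℤ m) {u v u′ v′} → Difference a u v → Difference b u′ v′ →
  Difference (zipWith ℤ._+_ a b) (zipWith _+_ u u′) (zipWith _+_ v v′)
difference-+ [] [] {[]} {[]} {[]} {[]} _ _ = tt
difference-+ (a ∷ as) (b ∷ bs) {u ∷ _} {v ∷ _} {u′ ∷ _} {v′ ∷ _} (eq , d) (eq′ , d′) =
  trans (cong (λ t → a ℤ.+ b ℤ.+ t) (pos-+ v v′)) (trans (shuffle a b (+ v) (+ v′))
    (trans (cong₂ ℤ._+_ eq eq′) (sym (pos-+ u u′)))) , difference-+ as bs d d′
  where
  shuffle : ∀ a b c d → a ℤ.+ b ℤ.+ (c ℤ.+ d) ≡ (a ℤ.+ c) ℤ.+ (b ℤ.+ d)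
  shuffle = solve-∀

difference-* : ∀ n (a : Vec ℤ m) {u v} → Difference a u v →
  Difference (Vec.map (λ x → + n ℤ.* x) a) (Vec.map (n *_) u) (Vec.map (n *_) v)
difference-* n [] {[]} {[]} _ = tt
difference-* n (a ∷ as) {u ∷ _} {v ∷ _} (eq , d) =
  trans (cong (λ t → + n ℤ.* a ℤ.+ t) (pos-* n v)) (trans (sym (ℤ.*-distribˡ-+ (+ n) a (+ v)))
    (trans (cong (λ t → + n ℤ.* t) eq) (sym (pos-* n u)))) , difference-* n as d

difference-neg* : ∀ n (a : Vec ℤ m) {u v} → Difference a u v →
  Difference (Vec.map (λ x → ℤ.- + n ℤ.* x) a) (Vec.map (n *_) v) (Vec.map (n *_) u)
difference-neg* n [] {[]} {[]} _ = tt
difference-neg* n (a ∷ as) {u ∷ _} {v ∷ _} (eq , d) =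
  trans (cong (λ t → ℤ.- + n ℤ.* a ℤ.+ t) (trans (pos-* n u) (cong (λ t → + n ℤ.* t) (sym eq))))
    (trans (simplify (+ n) a (+ v)) (sym (pos-* n v))) , difference-neg* n as d
  where
  simplify : ∀ n a v → ℤ.- n ℤ.* a ℤ.+ n ℤ.* (a ℤ.+ v) ≡ n ℤ.* v
  simplify = solve-∀

-- Equality of formal differences, as in the Grothendieck group of ℕᵐ.
difference-unique : ∀ (a : Vec ℤ m) {u v u′ v′} → Difference a u v → Difference a u′ v′ →
  zipWith _+_ u v′ ≡ zipWith _+_ u′ v
difference-unique [] {[]} {[]} {[]} {[]} _ _ = refl
difference-unique (a ∷ as) {u ∷ _} {v ∷ _} {u′ ∷ _} {v′ ∷ _} (eq , d) (eq′ , d′) = cong₂ _∷_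
  (ℤ.+-injective (trans (pos-+ u v′) (trans (cong (λ t → t ℤ.+ + v′) (sym eq)) (trans (swap a (+ v) (+ v′))
    (trans (cong (λ t → t ℤ.+ + v) eq′) (sym (pos-+ u′ v)))))))
  (difference-unique as d d′)
  where
  swap : ∀ a v w → a ℤ.+ v ℤ.+ w ≡ a ℤ.+ w ℤ.+ v
  swap = solve-∀

module _ {g h : Vec ℕ m} (g>0 : Positive g) (h>0 : Positive h) where

  -- (g/h)^u = (g/h)^v with cleared denominators.
  Balanced : Vec ℕ m → Vec ℕ m → Set
  Balanced u v = monomial u g * monomial v h ≡ monomial v g * monomial u h

  -- The value of (g/h)^(u - v) depends on the difference alone. After multiplication by g^v h^v
  -- both sides match, and positivity allows this factor to be cancelled.
  balanced-transfer : ∀ {u v u′ v′} → zipWith _+_ u v′ ≡ zipWith _+_ u′ v → Balanced u v → Balanced u′ v′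
  balanced-transfer {u} {v} {u′} {v′} eq bal =
    ℕ.*-cancelˡ-≡ _ _ (monomial v g * monomial v h)
      {{ℕ.m*n≢0 _ _ {{monomial-nonZero g>0 v}} {{monomial-nonZero h>0 v}}}} (begin
    gv * hv * (gu′ * hv′)   ≡⟨ eq₁ gv hv gu′ hv′ ⟩
    (gu′ * gv) * (hv * hv′) ≡⟨ cong (_* (hv * hv′)) (cross g) ⟨
    (gu * gv′) * (hv * hv′) ≡⟨ eq₂ gu gv′ hv hv′ ⟩
    (gu * hv) * (gv′ * hv′) ≡⟨ cong (_* (gv′ * hv′)) bal ⟩
    (gv * hu) * (gv′ * hv′) ≡⟨ eq₃ gv hu gv′ hv′ ⟩
    gv * gv′ * (hu * hv′)   ≡⟨ cong (gv * gv′ *_) (cross h) ⟩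
    gv * gv′ * (hu′ * hv)   ≡⟨ eq₄ gv gv′ hu′ hv ⟩
    gv * hv * (gv′ * hu′)   ∎)
    where
    open ≡-Reasoning
    gu = monomial u g
    gv = monomial v g
    gu′ = monomial u′ g
    gv′ = monomial v′ g
    hu = monomial u h
    hv = monomial v h
    hu′ = monomial u′ h
    hv′ = monomial v′ h
    cross : ∀ x → monomial u x * monomial v′ x ≡ monomial u′ x * monomial v x
    cross x = trans (sym (monomial-+ u v′ x)) (trans (cong (λ w → monomial w x) eq) (monomial-+ u′ v x))
    eq₁ : ∀ a b c d → a * b * (c * d) ≡ (c * a) * (b * d)
    eq₁ = solveℕ-∀
    eq₂ : ∀ a b c d → (a * b) * (c * d) ≡ (a * c) * (b * d)
    eq₂ = solveℕ-∀
    eq₃ : ∀ a b c d → (a * b) * (c * d) ≡ a * c * (b * d)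
    eq₃ = solveℕ-∀
    eq₄ : ∀ a b c d → a * b * (c * d) ≡ a * d * (b * c)
    eq₄ = solveℕ-∀

  balanced-+ : ∀ {u v u′ v′} → Balanced u v → Balanced u′ v′ → Balanced (zipWith _+_ u u′) (zipWith _+_ v v′)
  balanced-+ {u} {v} {u′} {v′} p q
    rewrite monomial-+ u u′ g | monomial-+ v v′ h | monomial-+ v v′ g | monomial-+ u u′ h =
    trans (*-interchange (monomial u g) _ _ _) (trans (cong₂ _*_ p q) (*-interchange (monomial v g) _ _ _))

  balanced-* : ∀ n {u v} → Balanced u v → Balanced (Vec.map (n *_) u) (Vec.map (n *_) v)
  balanced-* n {u} {v} p
    rewrite monomial-* n u g | monomial-* n v h | monomial-* n v g | monomial-* n u h =
    trans (sym (^-distribʳ-* n (monomial u g) _)) (trans (cong (_^ n) p) (^-distribʳ-* n (monomial v g) _))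

  balanced-*⁻ : ∀ n {u v} → Balanced (Vec.map (suc n *_) u) (Vec.map (suc n *_) v) → Balanced u v
  balanced-*⁻ n {u} {v} p
    rewrite monomial-* (suc n) u g | monomial-* (suc n) v h | monomial-* (suc n) v g | monomial-* (suc n) u h =
    ^-cancelʳ-≡ n _ _ (trans (^-distribʳ-* (suc n) (monomial u g) _)
      (trans p (sym (^-distribʳ-* (suc n) (monomial v g) _))))

  -- The kernel of the map sending `a` to (g/h)^a. By `balanced-transfer` it does not matter which
  -- representation of `a` as a difference is exhibited.
  Relations : Pred (Vec ℤ m) 0ℓ
  Relations a = ∃[ u ] ∃[ v ] Difference a u v × Balanced u v

  relations-scale : ∀ α {a} → Relations a → Relations (Vec.map (α ℤ.*_) a)
  relations-scale (+ n) {a} (u , v , d , bal) = _ , _ , difference-* n a d , balanced-* n {u} {v} bal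
  relations-scale (-[1+ n ]) {a} (u , v , d , bal) =
    _ , _ , difference-neg* (suc n) a d , balanced-* (suc n) {v} {u} (sym bal)

  relations-+ : ∀ {a b} → Relations a → Relations b → Relations (zipWith ℤ._+_ a b)
  relations-+ {a} {b} (u , v , d , bal) (u′ , v′ , d′ , bal′) =
    _ , _ , difference-+ a b d d′ , balanced-+ {u} {v} {u′} {v′} bal bal′

  -- A kernel is a subgroup, and this one is saturated because a positive rational with a nonzero
  -- power equal to 1 is itself 1.
  relations-saturated : SaturatedSubgroup Relations
  relations-saturated = record
    { closed = λ α β {a} {b} p q →
        subst Relations (lincomb-split α β a b) (relations-+ {Vec.map (α ℤ.*_) a} (relations-scale α p) (relations-scale β q))
    ; saturated = saturate }
    where
    lincomb-split : ∀ {m} α β (a b : Vec ℤ m) →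
      zipWith ℤ._+_ (Vec.map (α ℤ.*_) a) (Vec.map (β ℤ.*_) b) ≡ lincomb α a β b
    lincomb-split α β [] [] = refl
    lincomb-split α β (_ ∷ a) (_ ∷ b) = cong (_ ∷_) (lincomb-split α β a b)

    saturate : ∀ k {a} → k ≢ 0ℤ → Relations (Vec.map (k ℤ.*_) a) → Relations a
    saturate (+ zero) k≢0 _ = contradiction refl k≢0
    -- The given `u` and `v` represent the multiple of `a` and need not be divisible by `k`. The
    -- balance is moved to multiples of a fresh representation of `a`, where the root can be taken.
    -- A negative `k` exchanges the two sides, hence `sym` in the next case.
    saturate k@(+ suc n) {a} _ (u , v , d , bal) with difference a
    ... | p , q , d′ = p , q , d′ , balanced-*⁻ n {p} {q} (balanced-transfer {u} {v}
      (difference-unique (Vec.map (k ℤ.*_) a) d (difference-* (suc n) a d′)) bal)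
    saturate k@(-[1+ n ]) {a} _ (u , v , d , bal) with difference a
    ... | p , q , d′ = p , q , d′ , sym (balanced-*⁻ n {q} {p} (balanced-transfer {u} {v}
      (difference-unique (Vec.map (k ℤ.*_) a) d (difference-neg* (suc n) a d′)) bal))

  difference-pos : ∀ {m} (a : Vec ℕ m) → Difference (Vec.map +_ a) a (replicate m 0)
  difference-pos [] = tt
  difference-pos (a ∷ as) = ℤ.+-identityʳ (+ a) , difference-pos as

  relations⁺ : ∀ a → monomial a g ≡ monomial a h → Relations (Vec.map +_ a)
  relations⁺ a eq = a , replicate m 0 , difference-pos a ,
    trans (cong (monomial a g *_) (monomial-0 h)) (trans (ℕ.*-identityʳ _) (trans eq
      (trans (sym (ℕ.*-identityˡ _)) (cong (_* monomial a h) (sym (monomial-0 g))))))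

  relations⁻ : ∀ a → Relations (Vec.map +_ a) → monomial a g ≡ monomial a h
  relations⁻ a (u , v , d , bal) = trans (sym (ℕ.*-identityʳ _)) (trans (cong (monomial a g *_) (sym (monomial-0 h)))
    (trans (balanced-transfer {u} {v} {a} {replicate m 0} (difference-unique (Vec.map +_ a) d (difference-pos a)) bal)
      (trans (cong (_* monomial a h) (monomial-0 g)) (ℕ.*-identityˡ _))))

-- Homomorphism counts as monomials in the counts of components

homVector : ∀ Gs → Graph → Vec ℕ (length Gs)
homVector Gs G = Vec.map (λ C → hom C G) (fromList Gs)

increment : {Gs : List Graph} {P : Pred Graph 0ℓ} → Any P Gs → Vec ℕ (length Gs) → Vec ℕ (length Gs)
increment (here _) (a ∷ as) = suc a ∷ as
increment (there i) (a ∷ as) = a ∷ increment i as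

monomial-increment : ∀ {Gs} C (i : Any (C ≅_) Gs) a G →
  monomial (increment i a) (homVector Gs G) ≡ hom C G * monomial a (homVector Gs G)
monomial-increment {Gs = C′ ∷ Gs} C (here C≅C′) (a ∷ as) G =
  trans (ℕ.*-assoc (hom C′ G) _ _)
    (cong (_* (hom C′ G ^ a * monomial as (homVector Gs G))) (sym (hom-≅ {C} {C′} C≅C′ G)))
monomial-increment {Gs = C′ ∷ Gs} C (there i) (a ∷ as) G = trans (cong (hom C′ G ^ a *_) (monomial-increment C i as G))
  (*-swap (hom C′ G ^ a) (hom C G) _)

Exponents : List Graph → Graph → Set
Exponents Gs F = Σ[ a ∈ Vec ℕ (length Gs) ] (∀ G → hom F G ≡ monomial a (homVector Gs G))

-- The component of vertex `zero` is split off and contributes one factor. Components of the rest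
-- are components of `F`, so the hypothesis passes on. The rest is no subterm of `F`; the bound `k`
-- on the order carries the recursion.
hom-factorises : (∀ (P : Set) → Dec P) → ∀ Gs k F → order F < k →
  (∀ {C} → IsComponentOf C F → Any (C ≅_) Gs) → Exponents Gs F
hom-factorises dec Gs (suc k) record { order = zero } _ _ =
  replicate _ 0 , λ G → sym (monomial-0 (homVector Gs G))
hom-factorises dec Gs (suc k) F@record { order = suc _ } (s≤s |F|≤k) components =
  increment i (proj₁ rest) , λ G → trans (hom-disjoint F R closed G)
    (trans (cong (hom (inside F R closed) G *_) (proj₂ rest G))
      (sym (monomial-increment (inside F R closed) i (proj₁ rest) G)))
  where
  reach? : ∀ w → Dec (Star (Adj F) zero w)
  reach? w = dec _

  R : Vertex F → Bool
  R w = does (reach? w)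

  reach : ∀ w → R w ≡ true ⇔ Star (Adj F) zero w
  reach w with reach? w
  ... | yes p = mk⇔ (λ _ → p) (λ _ → refl)
  ... | no ¬p = mk⇔ (λ ()) (λ p → contradiction p ¬p)

  closed : ∀ u v → Adj F u v → R u ≡ R v
  closed u v uv with reach? u | reach? v
  ... | yes _ | yes _ = refl
  ... | no _  | no _  = refl
  ... | yes p | no ¬q = contradiction (p ◅◅ uv ◅ ε) ¬q
  ... | no ¬p | yes q = contradiction (q ◅◅ trans (adj-sym F v u) uv ◅ ε) ¬p

  i : Any (inside F R closed ≅_) Gs
  i = components {inside F R closed} (component-inside F R closed zero reach)

  rest : Exponents Gs (outside F R closed)
  rest = hom-factorises dec Gs k (outside F R closed)
    (ℕ.<-≤-trans (order-outside F R closed zero (Equivalence.from (reach zero) ε)) |F|≤k)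
    (λ {K} K-D → components {K} (component-outside F R closed {K} K-D))

-- Patterns of vanishing counts

allVecs : List A → ∀ k → List (Vec A k)
allVecs xs zero = [] ∷ []
allVecs xs (suc k) = cartesianProductWith _∷_ xs (allVecs xs k)

∈-allVecs : {xs : List A} → (∀ x → x ∈ xs) → ∀ {k} (v : Vec A k) → v ∈ allVecs xs k
∈-allVecs all∈ [] = here refl
∈-allVecs all∈ (x ∷ v) = ∈-cartesianProductWith⁺ _∷_ (all∈ x) (∈-allVecs all∈ v)

isZero : ℕ → Bool
isZero zero = true
isZero (suc _) = false

-- Tells from the zero pattern of the bases whether the monomial vanishes. Entries with exponent 0
-- are skipped because `0 ^ 0` is 1.
hits : Vec ℕ m → Vec Bool m → Bool
hits [] [] = false
hits (zero ∷ as) (_ ∷ zs) = hits as zs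
hits (suc _ ∷ as) (z ∷ zs) = z ∨ hits as zs

-- In a monomial that is not hit, every vanishing base has exponent 0, so putting 1 in its place
-- keeps the value and makes all bases positive.
zero↦one : ℕ → ℕ
zero↦one zero = 1
zero↦one (suc n) = suc n

positive : (g : Vec ℕ m) → Positive (Vec.map zero↦one g)
positive [] = []
positive (zero ∷ g) = _ ∷ positive g
positive (suc _ ∷ g) = _ ∷ positive g

monomial-hit : ∀ (a g : Vec ℕ m) → hits a (Vec.map isZero g) ≡ true → monomial a g ≡ 0
monomial-hit [] [] ()
monomial-hit (zero ∷ as) (g ∷ gs) eq = trans (ℕ.+-identityʳ _) (monomial-hit as gs eq)
monomial-hit (suc _ ∷ as) (zero ∷ gs) eq = refl
monomial-hit (suc a ∷ as) (suc g ∷ gs) eq =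
  trans (cong (suc g ^ suc a *_) (monomial-hit as gs eq)) (ℕ.*-zeroʳ (suc g ^ suc a))

monomial-miss : ∀ (a g : Vec ℕ m) → hits a (Vec.map isZero g) ≡ false →
  monomial a g ≡ monomial a (Vec.map zero↦one g)
monomial-miss [] [] eq = refl
monomial-miss (zero ∷ as) (g ∷ gs) eq = cong (1 *_) (monomial-miss as gs eq)
monomial-miss (suc _ ∷ as) (zero ∷ gs) ()
monomial-miss (suc a ∷ as) (suc g ∷ gs) eq = cong (suc g ^ suc a *_) (monomial-miss as gs eq)

hit≢miss : ∀ (a g h : Vec ℕ m) → hits a (Vec.map isZero g) ≡ true → hits a (Vec.map isZero h) ≡ false →
  monomial a g ≢ monomial a h
hit≢miss a g h hit miss eq = ≢-nonZero⁻¹ _ {{monomial-nonZero (positive h) a}}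
  (trans (sym (monomial-miss a h miss)) (trans (sym eq) (monomial-hit a g hit)))

Agree : Vec ℕ m → Vec ℕ m → Pred (Vec ℕ m) 0ℓ
Agree g h a = monomial a g ≡ monomial a h

BasisFor : Pred (Vec ℕ m) ℓ → (Vec ℕ m → Vec ℕ m → Set) → Set ℓ
BasisFor A Q = Σ[ as ∈ List _ ] All A as ×
  (∀ {g h} → Q g h → All (Agree g h) as → ∀ {a} → A a → Agree g h a)


-- For positive bases, agreement on `a` is membership of its image in `Relations`, so the basis
-- theorem applies to the image of `A` in ℤᵐ. Its members carry their preimages in `A` along.
positive-basis : ExcludedMiddle ℓ → (A : Pred (Vec ℕ m) ℓ) → BasisFor A (λ g h → Positive g × Positive h)
positive-basis em A = All.reduce proj₁ members , reduced members , λ { {g} {h} (g>0 , h>0) agree {a} Aa →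
    relations⁻ g>0 h>0 a (spanning (relations-saturated g>0 h>0) (related g>0 h>0 members agree) (a , Aa , refl)) }
  where
  open FiniteBasis (finite-basis em λ z → ∃[ a ] A a × z ≡ Vec.map +_ a)

  reduced : ∀ {zs} (ps : All (λ z → ∃[ a ] A a × z ≡ Vec.map +_ a) zs) → All A (All.reduce proj₁ ps)
  reduced [] = []
  reduced ((_ , Aa , _) ∷ ps) = Aa ∷ reduced ps

  related : ∀ {g h} (g>0 : Positive g) (h>0 : Positive h) {zs} (ps : All (λ z → ∃[ a ] A a × z ≡ Vec.map +_ a) zs) →
    All (Agree g h) (All.reduce proj₁ ps) → All (Relations g>0 h>0) zs
  related _ _ [] [] = []
  related g>0 h>0 ((a , _ , refl) ∷ ps) (eq ∷ eqs) = relations⁺ g>0 h>0 a eq ∷ related g>0 h>0 ps eqs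

HasZeros : Vec Bool m → Vec Bool m → Vec ℕ m → Vec ℕ m → Set
HasZeros P Q g h = Vec.map isZero g ≡ P × Vec.map isZero h ≡ Q

hits-agree : ∀ a {P Q} {g h : Vec ℕ m} → HasZeros P Q g h → monomial a g ≡ monomial a h → hits a P ≡ hits a Q
hits-agree a {g = g} {h} (refl , refl) eq with hits a (Vec.map isZero g) in eq₁ | hits a (Vec.map isZero h) in eq₂
... | true  | true  = refl
... | false | false = refl
... | true  | false = contradiction eq (hit≢miss a g h eq₁ eq₂)
... | false | true  = contradiction (sym eq) (hit≢miss a h g eq₂ eq₁)

-- A vector hit by exactly one of the patterns gives 0 on one side and a positive number on the
-- other, so as a one-element basis it makes the agreement hypothesis contradictory. If there is
-- none, vectors hit by both patterns agree as 0 = 0, and the others do not see the zeros at all.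
pattern-basis : ExcludedMiddle ℓ → (A : Pred (Vec ℕ m) ℓ) → ∀ P Q → BasisFor A (HasZeros P Q)
pattern-basis {m = m} em A P Q with em {∃[ a ] A a × hits a P ≢ hits a Q}
... | yes (a , Aa , differ) = a ∷ [] , Aa ∷ [] , λ { zs (eq ∷ []) → contradiction (hits-agree a zs eq) differ }
... | no same = as , All.map proj₁ As , conclude
  where
  Missing : Pred (Vec ℕ m) _
  Missing a = A a × hits a P ≡ false × hits a Q ≡ false

  basis = positive-basis em Missing
  as = proj₁ basis
  As = proj₁ (proj₂ basis)
  span = proj₂ (proj₂ basis)

  same-hits : ∀ {a} → A a → hits a P ≡ hits a Q
  same-hits {a} Aa with hits a P ≟ᵇ hits a Q
  ... | yes eq = eq
  ... | no ne = contradiction (a , Aa , ne) same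

  miss : ∀ b {g Z} → Vec.map isZero g ≡ Z → hits b Z ≡ false → monomial b g ≡ monomial b (Vec.map zero↦one g)
  miss b refl = monomial-miss b _

  hit : ∀ b {g Z} → Vec.map isZero g ≡ Z → hits b Z ≡ true → monomial b g ≡ 0
  hit b refl = monomial-hit b _

  conclude : ∀ {g h} → HasZeros P Q g h → All (Agree g h) as → ∀ {a} → A a → Agree g h a
  conclude {g} {h} (zg , zh) agree {a} Aa with hits a P in eq
  ... | true = trans (hit a zg eq) (sym (hit a zh (trans (sym (same-hits Aa)) eq)))
  ... | false = trans (miss a zg eq) (trans
    (span (positive g , positive h)
      (All.zipWith (λ { {b} ((_ , missP , missQ) , eq) →
        trans (sym (miss b zg missP)) (trans eq (miss b zh missQ)) }) (As , agree))
      (Aa , eq , missQ))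
    (sym (miss a zh missQ)))
    where missQ = trans (sym (same-hits Aa)) eq

-- The bases of all pairs of patterns are joined; a given pair `g`, `h` consults only the part for
-- its own patterns.
monomial-basis : ExcludedMiddle ℓ → (A : Pred (Vec ℕ m) ℓ) →
  Σ[ as ∈ List (Vec ℕ m) ] All A as × (∀ g h → All (Agree g h) as → ∀ {a} → A a → Agree g h a)
monomial-basis {m = m} em A = concatMap (proj₁ ∘ basis) patterns ,
  All.concat⁺ (All.map⁺ (All.universal (λ PQ → proj₁ (proj₂ (basis PQ))) patterns)) ,
  λ g h agree {a} Aa → let PQ = Vec.map isZero g , Vec.map isZero h in
    proj₂ (proj₂ (basis PQ)) (refl , refl)
      (All.lookup (All.map⁻ {f = proj₁ ∘ basis} (All.concat⁻ agree)) (pattern∈ PQ)) Aa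
  where
  basis : (PQ : Vec Bool m × Vec Bool m) → _
  basis (P , Q) = pattern-basis em A P Q

  Bools = true ∷ false ∷ []
  ∈-Bools : ∀ b → b ∈ Bools
  ∈-Bools true = here refl
  ∈-Bools false = there (here refl)

  patterns : List (Vec Bool m × Vec Bool m)
  patterns = cartesianProduct (allVecs Bools m) (allVecs Bools m)

  pattern∈ : ∀ PQ → PQ ∈ patterns
  pattern∈ (P , Q) = ∈-cartesianProduct⁺ (∈-allVecs ∈-Bools P) (∈-allVecs ∈-Bools Q)

-- `Factors` keeps with each exponent vector a member of `𝓕` realising it, so the basis leads back
-- to graphs of `𝓕`. One direction is then mere restriction.
finite-subclass : ExcludedMiddle ℓ → (𝓕 : Pred Graph ℓ) → EssentiallyFinite 𝓕 →
  Σ[ Fs ∈ List Graph ] (∀ G H → G ≡[ 𝓕 ] H ⇔ G ≡[ _∈ Fs ] H)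
finite-subclass {ℓ} em 𝓕 (Gs , complete) = Fs As , λ G H →
  mk⇔ {A = G ≡[ 𝓕 ] H} {B = G ≡[ _∈ Fs As ] H}
    (λ p {F} → restrict G H p {F}) (λ p {F} → extend G H (λ {F′} → p {F′}) {F})
  where
  Factors : Pred (Vec ℕ (length Gs)) ℓ
  Factors a = ∃[ F ] 𝓕 F × (∀ G → hom F G ≡ monomial a (homVector Gs G))

  exponents : ∀ F → 𝓕 F → Exponents Gs F
  -- Reachability lives in `Set`, so it is lifted to level `ℓ` before `em` decides it.
  exponents F 𝓕F = hom-factorises (λ P → map′ lower lift (em {Lift ℓ P})) Gs _ F ℕ.≤-refl
    λ {C} C-F → complete {C} (F , 𝓕F , C-F)

  basis = monomial-basis em Factors
  As = proj₁ (proj₂ basis)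
  span = proj₂ (proj₂ basis)

  Fs : ∀ {as} → All Factors as → List Graph
  Fs = All.reduce proj₁

  Fs-𝓕 : ∀ {as} (As : All Factors as) → All 𝓕 (Fs As)
  Fs-𝓕 [] = []
  Fs-𝓕 ((_ , 𝓕F , _) ∷ As) = 𝓕F ∷ Fs-𝓕 As

  agree : ∀ G H {as} (As : All Factors as) → All (λ F → hom F G ≡ hom F H) (Fs As) →
    All (Agree (homVector Gs G) (homVector Gs H)) as
  agree G H [] [] = []
  agree G H ((F , _ , factors) ∷ As) (eq ∷ eqs) = trans (sym (factors G)) (trans eq (factors H)) ∷ agree G H As eqs

  restrict : ∀ G H → G ≡[ 𝓕 ] H → G ≡[ _∈ Fs As ] H
  restrict G H G≡H {F} F∈Fs = G≡H {F} (All.lookup (Fs-𝓕 As) F∈Fs)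

  extend : ∀ G H → G ≡[ _∈ Fs As ] H → G ≡[ 𝓕 ] H
  extend G H G≡H {F} 𝓕F =
    let a , factors = exponents F 𝓕F
        homs-agree = agree G H As (All.tabulate λ {C} C∈Fs → G≡H {C} C∈Fs)
    in trans (factors G) (trans
      (span (homVector Gs G) (homVector Gs H) homs-agree {a} (F , 𝓕F , factors)) (sym (factors H)))

-- Turing machines as programs over counters

-- All tapes are read-only after initialisation, so a configuration is the vector of head
-- positions: a work tape whose cell 0 alone is marked serves as a counter.
data Program (T : ℕ) : Set where
  shift : Vec Move T → Program T
  _⨾_   : Program T → Program T → Program T
  when  : Fin T → (Symbol → Bool) → Program T → Program T → Program T
  while : Fin T → (Symbol → Bool) → Program T → Program T

infixr 5 _⨾_

-- For `when` and `while`, `nothing` is the state that performs the test, and `just` embeds the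
-- states of the branches or the body.
State : Program T → Set
State (shift _)      = ⊤
State (p ⨾ q)        = State p ⊎ State q
State (when _ _ p q) = Maybe (State p ⊎ State q)
State (while _ _ p)  = Maybe (State p)

entry : (p : Program T) → State p
entry (shift _)      = tt
entry (p ⨾ q)        = inj₁ (entry p)
entry (when _ _ _ _) = nothing
entry (while _ _ _)  = nothing

-- nothing as successor state means that the program is left.
transition : (p : Program T) → State p → Vec Symbol T → Maybe (State p) × Vec Move T
transition (shift e) _ _ = nothing , e
transition (p ⨾ q) (inj₁ x) σ = Product.map₁ (just ∘ maybe inj₁ (inj₂ (entry q))) (transition p x σ)
transition (p ⨾ q) (inj₂ y) σ = Product.map₁ (Maybe.map inj₂) (transition q y σ)
transition (when i test p q) nothing σ =
  just (just (if test (lookup σ i) then inj₁ (entry p) else inj₂ (entry q))) , replicate _ stay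
transition (when i test p q) (just (inj₁ x)) σ = Product.map₁ (Maybe.map (just ∘ inj₁)) (transition p x σ)
transition (when i test p q) (just (inj₂ y)) σ = Product.map₁ (Maybe.map (just ∘ inj₂)) (transition q y σ)
transition (while i test p) nothing σ =
  (if test (lookup σ i) then just (just (entry p)) else nothing) , replicate _ stay
-- Leaving the body, `nothing`, becomes `just nothing`, which is the test of the loop.
transition (while i test p) (just x) σ = Product.map₁ just (transition p x σ)

record Enumeration (S : Set) : Set where
  field
    size          : ℕ
    encodeState   : S → Fin size
    decodeState   : Fin size → S
    decode-encode : ∀ x → decodeState (encodeState x) ≡ x

open Enumeration

enumerate-⊤ : Enumeration ⊤
enumerate-⊤ = record { size = 1 ; encodeState = λ _ → zero ; decodeState = λ _ → tt ; decode-encode = λ _ → refl }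

enumerate-⊎ : ∀ {S S′} → Enumeration S → Enumeration S′ → Enumeration (S ⊎ S′)
enumerate-⊎ E E′ = record
  { size = size E + size E′
  ; encodeState = λ x → join (size E) (size E′) (Sum.map (encodeState E) (encodeState E′) x)
  ; decodeState = λ i → Sum.map (decodeState E) (decodeState E′) (splitAt (size E) i)
  ; decode-encode = λ
    { (inj₁ x) → trans (cong (Sum.map _ _) (splitAt-join (size E) _ (inj₁ _))) (cong inj₁ (decode-encode E x))
    ; (inj₂ y) → trans (cong (Sum.map _ _) (splitAt-join (size E) _ (inj₂ _))) (cong inj₂ (decode-encode E′ y)) } }

enumerate-Maybe : ∀ {S} → Enumeration S → Enumeration (Maybe S)
enumerate-Maybe E = record
  { size = suc (size E)
  ; encodeState = maybe (suc ∘ encodeState E) zero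
  ; decodeState = λ { zero → nothing ; (suc i) → just (decodeState E i) }
  ; decode-encode = λ { nothing → refl ; (just x) → cong just (decode-encode E x) } }

enumerate-State : (p : Program T) → Enumeration (State p)
enumerate-State (shift _)      = enumerate-⊤
enumerate-State (p ⨾ q)        = enumerate-⊎ (enumerate-State p) (enumerate-State q)
enumerate-State (when _ _ p q) = enumerate-Maybe (enumerate-⊎ (enumerate-State p) (enumerate-State q))
enumerate-State (while _ _ p)  = enumerate-Maybe (enumerate-State p)

-- No left move starts at position 0, so head positions stay in ℕ although the tapes are infinite in
-- both directions.
Moved : Move → ℕ → ℕ → Set
Moved left  n n′ = n ≡ suc n′
Moved stay  n n′ = n′ ≡ n
Moved right n n′ = n′ ≡ suc n

AllMoved : Vec Move T → Vec ℕ T → Vec ℕ T → Set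
AllMoved [] [] [] = ⊤
AllMoved (e ∷ es) (n ∷ ns) (n′ ∷ ns′) = Moved e n n′ × AllMoved es ns ns′

allStay : (s : Vec ℕ T) → AllMoved (replicate T stay) s s
allStay [] = tt
allStay (n ∷ s) = refl , allStay s

Contents : ℕ → Set
Contents T = Vec (ℕ → Symbol) T

read : Contents T → Vec ℕ T → Vec Symbol T
read = zipWith λ f n → f n

module _ (c : Contents T) where

  data Trace (p : Program T) : ℕ → State p → Vec ℕ T → Vec ℕ T → Set where
    exit : ∀ {x e s s′} → transition p x (read c s) ≡ (nothing , e) → AllMoved e s s′ → Trace p 1 x s s′
    step : ∀ {t x x′ e s s₁ s′} → transition p x (read c s) ≡ (just x′ , e) → AllMoved e s s₁ →
      Trace p t x′ s₁ s′ → Trace p (suc t) x s s′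

  record Runs (p : Program T) (s s′ : Vec ℕ T) (bound : ℕ) : Set where
    constructor runs
    field
      time    : ℕ
      bounded : time ≤ bound
      trace   : Trace p time (entry p) s s′

  private
    variable
      p q : Program T
      s s₁ s′ : Vec ℕ T
      b b′ t : ℕ
      i : Fin T
      test : Symbol → Bool

  weaken : b ≤ b′ → Runs p s s′ b → Runs p s s′ b′
  weaken b≤b′ (runs t t≤b tr) = runs t (ℕ.≤-trans t≤b b≤b′) tr

  ending-at : ∀ {s″} → s′ ≡ s″ → Runs p s s′ b → Runs p s s″ b
  ending-at refl r = r

  run-shift : ∀ {e} → AllMoved e s s′ → Runs (shift e) s s′ 1
  run-shift moved = runs 1 ℕ.≤-refl (exit refl moved)

  run-⨾ : Runs p s s₁ b → Runs q s₁ s′ b′ → Runs (p ⨾ q) s s′ (b + b′)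
  run-⨾ {p = p} {q = q} (runs t t≤b tr) (runs t′ t′≤b′ tr′) = runs (t + t′) (ℕ.+-mono-≤ t≤b t′≤b′) (first tr)
    where
    second : ∀ {t y s s′} → Trace q t y s s′ → Trace (p ⨾ q) t (inj₂ y) s s′
    second (exit eq moved) = exit (cong (Product.map₁ (Maybe.map inj₂)) eq) moved
    second (step eq moved tr) = step (cong (Product.map₁ (Maybe.map inj₂)) eq) moved (second tr)

    first : ∀ {t x s} → Trace p t x s _ → Trace (p ⨾ q) (t + t′) (inj₁ x) s _
    first (exit eq moved) = step (cong (Product.map₁ (just ∘ maybe inj₁ (inj₂ (entry q)))) eq) moved (second tr′)
    first (step eq moved tr) = step (cong (Product.map₁ (just ∘ maybe inj₁ (inj₂ (entry q)))) eq) moved (first tr)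

  run-when-true : test (lookup (read c s) i) ≡ true → Runs p s s′ b → Runs (when i test p q) s s′ (suc b)
  run-when-true {test = test} {i = i} {p = p} {q = q} eq (runs t t≤b tr) =
    runs (suc t) (s≤s t≤b) (step
      (cong (λ r → just (just (if r then inj₁ (entry p) else inj₂ (entry q))) , _) eq) (allStay _) (go tr))
    where
    go : ∀ {t x s s′} → Trace p t x s s′ → Trace (when i test p q) t (just (inj₁ x)) s s′
    go (exit eq moved) = exit (cong (Product.map₁ (Maybe.map (just ∘ inj₁))) eq) moved
    go (step eq moved tr) = step (cong (Product.map₁ (Maybe.map (just ∘ inj₁))) eq) moved (go tr)

  run-when-false : test (lookup (read c s) i) ≡ false → Runs q s s′ b → Runs (when i test p q) s s′ (suc b)
  run-when-false {test = test} {i = i} {q = q} {p = p} eq (runs t t≤b tr) =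
    runs (suc t) (s≤s t≤b) (step
      (cong (λ r → just (just (if r then inj₁ (entry p) else inj₂ (entry q))) , _) eq) (allStay _) (go tr))
    where
    go : ∀ {t x s s′} → Trace q t x s s′ → Trace (when i test p q) t (just (inj₂ x)) s s′
    go (exit eq moved) = exit (cong (Product.map₁ (Maybe.map (just ∘ inj₂))) eq) moved
    go (step eq moved tr) = step (cong (Product.map₁ (Maybe.map (just ∘ inj₂))) eq) moved (go tr)

  run-while-stop : test (lookup (read c s) i) ≡ false → Runs (while i test p) s s 1
  run-while-stop {p = p} eq =
    runs 1 ℕ.≤-refl (exit (cong (λ r → (if r then just (just (entry p)) else nothing) , _) eq) (allStay _))

  run-while-step : test (lookup (read c s) i) ≡ true → Runs p s s₁ b → Runs (while i test p) s₁ s′ b′ →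
    Runs (while i test p) s s′ (suc b + b′)
  run-while-step {test = test} {i = i} {p = p} eq (runs t t≤b tr) (runs t′ t′≤b′ tr′) =
    runs (suc t + t′) (s≤s (ℕ.+-mono-≤ t≤b t′≤b′))
      (step (cong (λ r → (if r then just (just (entry p)) else nothing) , _) eq) (allStay _) (go tr))
    where
    go : ∀ {t x s} → Trace p t x s _ → Trace (while i test p) (t + t′) (just x) s _
    go (exit eq moved) = step (cong (Product.map₁ just) eq) moved tr′
    go (step eq moved tr) = step (cong (Product.map₁ just) eq) moved (go tr)

-- Simulation of counter programs by Turing machines

cell : List Symbol → ℕ → Symbol
cell [] _ = nothing
cell (x ∷ xs) zero = x
cell (x ∷ xs) (suc k) = cell xs k

-- The part before the head is an exact list because position 0 is its far end. The part after it is
-- compared cell by cell, since trailing blanks may or may not be stored.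
record Represents (f : ℕ → Symbol) (n : ℕ) (t : Tape) : Set where
  constructor represents
  field
    before≡ : before t ≡ List.map f (downFrom n)
    head≡   : head t ≡ f n
    after≡  : ∀ k → cell (after t) k ≡ f (suc (k + n))

AllRepresent : Contents T → Vec ℕ T → Vec Tape T → Set
AllRepresent [] [] [] = ⊤
AllRepresent (f ∷ c) (n ∷ s) (t ∷ ts) = Represents f n t × AllRepresent c s ts

represents-move : ∀ {f n n′ t} e → Represents f n t → Moved e n n′ → Represents f n′ (act (head t , e) t)
represents-move {f} {t = tape (x ∷ l) h r} left (represents refl h≡ r≡) refl =
  represents refl refl λ { zero → h≡ ; (suc k) → trans (r≡ k) (cong (f ∘ suc) (ℕ.+-suc k _)) }
represents-move {t = tape [] _ _} left (represents () _ _) refl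
represents-move stay rep refl = rep
represents-move {f} {n} {t = tape l h []} right (represents l≡ h≡ r≡) refl =
  represents (cong₂ _∷_ h≡ l≡) (r≡ 0) λ k → trans (r≡ (suc k)) (cong (f ∘ suc) (sym (ℕ.+-suc k n)))
represents-move {f} {n} {t = tape l h (x ∷ r)} right (represents l≡ h≡ r≡) refl =
  represents (cong₂ _∷_ h≡ l≡) (r≡ 0) λ k → trans (r≡ (suc k)) (cong (f ∘ suc) (sym (ℕ.+-suc k n)))

represent-moves : ∀ (c : Contents T) {s s′ ts} es → AllRepresent c s ts → AllMoved es s s′ →
  AllRepresent c s′ (zipWith act (zipWith _,_ (Vec.map head ts) es) ts)
represent-moves [] {[]} {[]} {[]} [] _ _ = tt
represent-moves (f ∷ c) {_ ∷ _} {_ ∷ _} {_ ∷ _} (e ∷ es) (rep , reps) (moved , moveds) =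
  represents-move e rep moved , represent-moves c es reps moveds

heads-read : ∀ (c : Contents T) {s ts} → AllRepresent c s ts → Vec.map head ts ≡ read c s
heads-read [] {[]} {[]} _ = refl
heads-read (f ∷ c) {_ ∷ _} {_ ∷ _} (represents _ h≡ _ , reps) = cong₂ _∷_ h≡ (heads-read c reps)

-- Cell 0 is the blank to the left of the input, so input symbol k is at position k + 1.
inputContent : List Bool → ℕ → Symbol
inputContent w zero = nothing
inputContent w (suc k) = cell (List.map just w) k

marked : ℕ → Symbol
marked zero = just true
marked (suc _) = nothing

isTrue : Symbol → Bool
isTrue (just b) = b
isTrue nothing = false

module _ {W : ℕ} where

  contents : List Bool → Contents (suc W)
  contents w = inputContent w ∷ replicate W marked

  -- Only `preparing` writes new symbols: it marks cell 0 of every work tape and moves the input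
  -- head onto the blank before the word. All later steps write back what they read.
  data Phase (S : Set) : Set where
    preparing deciding : Phase S
    running : S → Phase S
    decided : Bool → Phase S

  enumerate-Phase : ∀ {S} → Enumeration S → Enumeration (Phase S)
  enumerate-Phase E = record
    { size = 4 + size E
    ; encodeState = λ
      { preparing → zero ; deciding → suc zero ; (decided false) → suc (suc zero)
      ; (decided true) → suc (suc (suc zero)) ; (running x) → suc (suc (suc (suc (encodeState E x)))) }
    ; decodeState = λ
      { zero → preparing ; (suc zero) → deciding ; (suc (suc zero)) → decided false
      ; (suc (suc (suc zero))) → decided true ; (suc (suc (suc (suc i)))) → running (decodeState E i) }
    ; decode-encode = λ
      { preparing → refl ; deciding → refl ; (decided false) → refl ; (decided true) → refl
      ; (running x) → cong running (decode-encode E x) } }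

  module _ (p : Program (suc W)) (flag : Fin (suc W)) where

    phase-step : Phase (State p) → Vec Symbol (suc W) → Phase (State p) × Vec (Symbol × Move) (suc W)
    phase-step preparing (a ∷ _) = running (entry p) , (a , left) ∷ replicate W (just true , stay)
    phase-step (running x) σ =
      maybe running deciding (proj₁ (transition p x σ)) , zipWith _,_ σ (proj₂ (transition p x σ))
    -- On a work tape `isTrue` recognises the marked cell, so the machine accepts exactly when the
    -- counter `flag` stands at 0.
    phase-step deciding σ = decided (isTrue (lookup σ flag)) , zipWith _,_ σ (replicate _ stay)
    phase-step (decided b) σ = decided b , zipWith _,_ σ (replicate _ stay)

    phase-verdict : Phase (State p) → Maybe Bool
    phase-verdict (decided b) = just b
    phase-verdict _ = nothing

    private
      E : Enumeration (Phase (State p))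
      E = enumerate-Phase (enumerate-State p)

    machine : TuringMachine
    machine = record
      { workTapes = W
      ; states = size E
      ; start = encodeState E preparing
      ; verdict = phase-verdict ∘ decodeState E
      ; δ = λ q σ → Product.map₁ (encodeState E) (phase-step (decodeState E q) σ) }

    private
      next : Phase (State p) → Vec Tape (suc W) → Phase (State p) × Vec Tape (suc W)
      next x ts = proj₁ r , zipWith act (proj₂ r) ts
        where r = phase-step x (Vec.map head ts)

      within : ℕ → Phase (State p) → Vec Tape (suc W) → Maybe Bool
      within n x ts = runWithin machine n (encodeState E x , ts)

      within-decided : ∀ n b ts → within n (decided b) ts ≡ just b
      within-decided n true ts = refl
      within-decided n false ts = refl

      within-step : ∀ n x ts → phase-verdict x ≡ nothing →
        within (suc n) x ts ≡ within n (proj₁ (next x ts)) (proj₂ (next x ts))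
      within-step n x ts undecided rewrite decode-encode E x | undecided | decode-encode E x = refl

    private
      prepare : ∀ w → AllRepresent (contents w) (replicate _ 0)
        (proj₂ (next preparing (proj₂ (initial machine w))))
      prepare w = input w , works W
        where
        input : ∀ w → Represents (inputContent w) 0 (act (head (inputTape w) , left) (inputTape w))
        input [] = represents refl refl λ { zero → refl ; (suc k) → refl }
        input (b ∷ w) = represents refl refl λ
          { zero → refl ; (suc k) → cong (cell (List.map just w)) (sym (ℕ.+-identityʳ k)) }
        works : ∀ n → AllRepresent (replicate n marked) (replicate n 0)
          (zipWith act (replicate n (just true , stay)) (replicate n blankTape))
        works zero = tt
        works (suc n) = represents refl refl (λ k → refl) , works n

      follow : ∀ c {t x s s′ ts} n → Trace c p t x s s′ → AllRepresent c s ts →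
        ∃[ ts′ ] AllRepresent c s′ ts′ × within (t + n) (running x) ts ≡ within n deciding ts′
      follow c {x = x} {s} {ts = ts} n (exit {e = e} eq moved) rep = _ , represent-moves c e rep moved ,
        trans (within-step n (running x) ts refl) (cong (λ r → within n (maybe running deciding (proj₁ r))
            (zipWith act (zipWith _,_ (Vec.map head ts) (proj₂ r)) ts))
          (trans (cong (transition p x) (heads-read c rep)) eq))
      follow c {suc t} {x = x} {s} {ts = ts} n (step {e = e} eq moved trace) rep =
        let ts′ , rep′ , same = follow c n trace (represent-moves c e rep moved) in
        ts′ , rep′ , trans (within-step (t + n) (running x) ts refl)
          (trans (cong (λ r → within (t + n) (maybe running deciding (proj₁ r))
            (zipWith act (zipWith _,_ (Vec.map head ts) (proj₂ r)) ts))
          (trans (cong (transition p x) (heads-read c rep)) eq)) same)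

    -- Beyond `bound`, the fuel pays for the preparing and the deciding step and keeps one step in
    -- reserve.
    machine-run : ∀ w {s′ bound} → Runs (contents w) p (replicate _ 0) s′ bound →
      runWithin machine (3 + bound) (initial machine w) ≡ just (isTrue (lookup (read (contents w) s′) flag))
    machine-run w {s′} {bound} (runs t t≤bound trace) = begin
      within (3 + bound) preparing ts₀       ≡⟨ within-step (2 + bound) preparing ts₀ refl ⟩
      within (2 + bound) (running (entry p)) ts₁ ≡⟨ cong (λ n → within n (running (entry p)) ts₁) fuel ⟨
      within (t + suc rest) (running (entry p)) ts₁ ≡⟨ proj₂ (proj₂ followed) ⟩
      within (suc rest) deciding ts₂         ≡⟨ within-step rest deciding ts₂ refl ⟩
      within rest (decided (isTrue (lookup (Vec.map head ts₂) flag))) ts₃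
        ≡⟨ within-decided rest (isTrue (lookup (Vec.map head ts₂) flag)) ts₃ ⟩
      just (isTrue (lookup (Vec.map head ts₂) flag))
        ≡⟨ cong (λ σ → just (isTrue (lookup σ flag))) (heads-read (contents w) (proj₁ (proj₂ followed))) ⟩
      just (isTrue (lookup (read (contents w) s′) flag)) ∎
      where
      open ≡-Reasoning
      ts₀ = proj₂ (initial machine w)
      ts₁ = proj₂ (next preparing ts₀)
      rest = suc (bound ∸ t)
      fuel : t + suc rest ≡ 2 + bound
      fuel = trans (ℕ.+-suc t rest) (cong suc (trans (ℕ.+-suc t (bound ∸ t)) (cong suc (ℕ.m+[n∸m]≡n t≤bound))))
      followed = follow (contents w) (suc rest) trace (prepare w)
      ts₂ = proj₁ followed
      ts₃ = proj₂ (next deciding ts₂)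

-- Sweeps, loops and addition on counters

Swept : Move → ℕ → ℕ → ℕ → Set
Swept left  m n n′ = n ≡ m + n′
Swept stay  m n n′ = n′ ≡ n
Swept right m n n′ = n′ ≡ m + n

AllSwept : ℕ → Vec Move T → Vec ℕ T → Vec ℕ T → Set
AllSwept m [] [] [] = ⊤
AllSwept m (e ∷ es) (n ∷ s) (n′ ∷ s′) = Swept e m n n′ × AllSwept m es s s′

swept-zero : ∀ (e : Vec Move T) {s s′} → AllSwept 0 e s s′ → s ≡ s′
swept-zero [] {[]} {[]} _ = refl
swept-zero (left ∷ e) {_ ∷ _} {_ ∷ _} (refl , sw) = cong (_ ∷_) (swept-zero e sw)
swept-zero (stay ∷ e) {_ ∷ _} {_ ∷ _} (refl , sw) = cong (_ ∷_) (swept-zero e sw)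
swept-zero (right ∷ e) {_ ∷ _} {_ ∷ _} (refl , sw) = cong (_ ∷_) (swept-zero e sw)

swept-suc : ∀ (e : Vec Move T) {m s s′} → AllSwept (suc m) e s s′ → ∃[ s₁ ] AllMoved e s s₁ × AllSwept m e s₁ s′
swept-suc [] {s = []} {[]} _ = [] , tt , tt
swept-suc (left ∷ e) {s = _ ∷ _} {_ ∷ _} (refl , sw) =
  let s₁ , mv , sw′ = swept-suc e sw in _ ∷ s₁ , (refl , mv) , refl , sw′
swept-suc (stay ∷ e) {s = _ ∷ _} {_ ∷ _} (refl , sw) =
  let s₁ , mv , sw′ = swept-suc e sw in _ ∷ s₁ , (refl , mv) , refl , sw′
swept-suc (right ∷ e) {m} {s = n ∷ _} {_ ∷ _} (refl , sw) =
  let s₁ , mv , sw′ = swept-suc e sw in _ ∷ s₁ , (refl , mv) , sym (ℕ.+-suc m n) , sw′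

moved-lookup : ∀ {e : Vec Move T} {s s′} → AllMoved e s s′ → ∀ i → Moved (lookup e i) (lookup s i) (lookup s′ i)
moved-lookup {e = _ ∷ _} {_ ∷ _} {_ ∷ _} (m , _) zero = m
moved-lookup {e = _ ∷ _} {_ ∷ _} {_ ∷ _} (_ , ms) (suc i) = moved-lookup ms i

swept-pointwise : ∀ {m} {e : Vec Move T} {s s′} →
  (∀ i → Swept (lookup e i) m (lookup s i) (lookup s′ i)) → AllSwept m e s s′
swept-pointwise {e = []} {[]} {[]} _ = tt
swept-pointwise {e = _ ∷ _} {_ ∷ _} {_ ∷ _} sw = sw zero , swept-pointwise (sw ∘ suc)

swept-stay : ∀ m (s : Vec ℕ T) → AllSwept m (replicate T stay) s s
swept-stay m [] = tt
swept-stay m (_ ∷ s) = refl , swept-stay m s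

-- The head crosses `m` cells that pass the test and stops at one that fails. Quantifying over `n′`
-- deals with the partiality of the left move.
Passes : (ℕ → Symbol) → (Symbol → Bool) → Move → ℕ → ℕ → Set
Passes f test d zero n = test (f n) ≡ false
Passes f test d (suc m) n = test (f n) ≡ true × (∀ n′ → Moved d n n′ → Passes f test d m n′)

lookup-read : ∀ (c : Contents T) s i → lookup (read c s) i ≡ lookup c i (lookup s i)
lookup-read c s i = lookup-zipWith (λ f n → f n) i c s

-- Each round costs a test and a shift, and the failing test at the end costs one more step.
run-sweep : ∀ c (e : Vec Move T) i test m {s s′} → Passes (lookup c i) test (lookup e i) m (lookup s i) →
  AllSwept m e s s′ → Runs c (while i test (shift e)) s s′ (m * 2 + 1)
run-sweep c e i test zero {s} pass sw rewrite sym (swept-zero e sw) =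
  run-while-stop c (trans (cong test (lookup-read c s i)) pass)
run-sweep c e i test (suc m) {s} (now , later) sw =
  let s₁ , mv , sw′ = swept-suc e sw in
  run-while-step c (trans (cong test (lookup-read c s i)) now) (run-shift c mv)
    (run-sweep c e i test m (later _ (moved-lookup mv i)) sw′)

unmarked : Symbol → Bool
unmarked (just true) = false
unmarked _ = true

passes-marked : ∀ m → Passes marked unmarked left m m
passes-marked zero = refl
passes-marked (suc m) = refl , λ { _ refl → passes-marked m }

decrement : Fin T → Vec Move T
decrement i = replicate _ stay [ i ]≔ left

decrement-moved : ∀ (s : Vec ℕ T) i m → AllMoved (decrement i) (s [ i ]≔ suc m) (s [ i ]≔ m)
decrement-moved (_ ∷ s) zero m = refl , allStay s
decrement-moved (_ ∷ s) (suc i) m = refl , decrement-moved s i m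

-- The counter is decremented before the body, so a loop started at n runs its body with the values
-- n - 1, ..., 0, which are the vertex numbers of a graph of order n.
loop : Fin T → Program T → Program T
loop i p = while i unmarked (shift (decrement i) ⨾ p)

module _ (c : Contents T) (i : Fin T) (counter : lookup c i ≡ marked) where

  run-counter-sweep : ∀ (e : Vec Move T) m {s s′} → lookup e i ≡ left → lookup s i ≡ m →
    AllSwept m e s s′ → Runs c (while i unmarked (shift e)) s s′ (m * 2 + 1)
  run-counter-sweep e m eᵢ sᵢ sw = run-sweep c e i unmarked m (passes counter eᵢ sᵢ) sw
    where
    passes : ∀ {f d n} → f ≡ marked → d ≡ left → n ≡ m → Passes f unmarked d m n
    passes refl refl refl = passes-marked m

  test-counter : ∀ s {m} → lookup s i ≡ m → lookup (read c s) i ≡ marked m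
  test-counter s refl = trans (lookup-read c s i) (cong (λ f → f (lookup s i)) counter)

  run-loop-stop : ∀ {p s} → lookup s i ≡ 0 → Runs c (loop i p) s s 1
  run-loop-stop {s = s} sᵢ = run-while-stop c (cong unmarked (test-counter s sᵢ))

  run-loop-step : ∀ {p s s₁ s₂ s′ m b b′} → lookup s i ≡ suc m → AllMoved (decrement i) s s₁ → Runs c p s₁ s₂ b →
    Runs c (loop i p) s₂ s′ b′ → Runs c (loop i p) s s′ ((2 + b) + b′)
  run-loop-step {s = s} sᵢ mv r r′ =
    run-while-step c (cong unmarked (test-counter s sᵢ)) (run-⨾ c (run-shift c mv) r) r′

iterate↓ : {V : Set} → (ℕ → V → V) → ℕ → V → V
iterate↓ φ zero v = v
iterate↓ φ (suc m) v = iterate↓ φ m (φ m v)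

module _ (c : Contents T) (i : Fin T) (counter : lookup c i ≡ marked) where

  -- `S m v` is the invariant: the configuration with counter `m` and accumulated value `v`. The
  -- body may read the counter as data provided that it restores it. The 2 in the cost stands for
  -- test and decrement.
  run-loop : ∀ {V : Set} {p b} (S : ℕ → V → Vec ℕ T) (φ : ℕ → V → V) M →
    (∀ m v → lookup (S m v) i ≡ m) → (∀ m v → AllMoved (decrement i) (S (suc m) v) (S m v)) →
    (∀ m v → m < M → Runs c p (S m v) (S m (φ m v)) b) →
    ∀ v → Runs c (loop i p) (S M v) (S 0 (iterate↓ φ M v)) (M * (2 + b) + 1)
  run-loop S φ zero count dec body v = run-loop-stop c i counter (count 0 v)
  run-loop {b = b} S φ (suc M) count dec body v =
    weaken c (ℕ.≤-reflexive (sym (ℕ.+-assoc (2 + b) (M * (2 + b)) 1)))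
      (run-loop-step c i counter (count (suc M) v) (dec M v) (body M v ℕ.≤-refl)
        (run-loop S φ M count dec (λ m v m<M → body m v (ℕ.m<n⇒m<1+n m<M)) (φ M v)))

-- tmp takes a copy from which src is restored.
module Addition (src dst tmp : Fin T) where

  out back : Fin T → Move
  out j with j Fin.≟ src | j Fin.≟ dst | j Fin.≟ tmp
  ... | yes _ | _     | _     = left
  ... | no _  | yes _ | _     = right
  ... | no _  | no _  | yes _ = right
  ... | no _  | no _  | no _  = stay
  back j with j Fin.≟ src | j Fin.≟ tmp
  ... | yes _ | _     = right
  ... | no _  | yes _ = left
  ... | no _  | no _  = stay

  add : Program T
  add = while src unmarked (shift (tabulate out)) ⨾ while tmp unmarked (shift (tabulate back))

  module _ (c : Contents T) (src-counter : lookup c src ≡ marked) (tmp-counter : lookup c tmp ≡ marked)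
    (src≢dst : src ≢ dst) (src≢tmp : src ≢ tmp) (dst≢tmp : dst ≢ tmp) where

    -- The tape `dst` may be the input tape as well as a counter; adding to the input head is how a
    -- computed address is visited.
    run-add : ∀ s → lookup s tmp ≡ 0 →
      Runs c add s (s [ dst ]≔ (lookup s src + lookup s dst)) ((lookup s src * 2 + 1) + (lookup s src * 2 + 1))
    run-add s tmp≡0 = run-⨾ c {s₁ = tabulate middle}
      (run-counter-sweep c src src-counter (tabulate out) x (trans (lookup∘tabulate out src) out-src) refl
        (swept-pointwise λ j → subst₂ (λ e n → Swept e x (lookup s j) n)
          (sym (lookup∘tabulate out j)) (sym (lookup∘tabulate middle j)) (out-swept j)))
      (run-counter-sweep c tmp tmp-counter (tabulate back) x (trans (lookup∘tabulate back tmp) back-tmp)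
        (trans (lookup∘tabulate middle tmp) middle-tmp)
        (swept-pointwise λ j → subst₂ (λ e n → Swept e x n (lookup (s [ dst ]≔ (x + lookup s dst)) j))
          (sym (lookup∘tabulate back j)) (sym (lookup∘tabulate middle j)) (back-swept j)))
      where
      x = lookup s src

      middle : Fin T → ℕ
      middle j with j Fin.≟ src | j Fin.≟ dst | j Fin.≟ tmp
      ... | yes _ | _     | _     = 0
      ... | no _  | yes _ | _     = x + lookup s dst
      ... | no _  | no _  | yes _ = x
      ... | no _  | no _  | no _  = lookup s j

      out-src : out src ≡ left
      out-src with src Fin.≟ src
      ... | yes _ = refl
      ... | no src≢src = contradiction refl src≢src

      back-tmp : back tmp ≡ left
      back-tmp with tmp Fin.≟ src | tmp Fin.≟ tmp
      ... | yes eq | _ = contradiction (sym eq) src≢tmp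
      ... | no _ | yes _ = refl
      ... | no _ | no tmp≢tmp = contradiction refl tmp≢tmp

      middle-tmp : middle tmp ≡ x
      middle-tmp with tmp Fin.≟ src | tmp Fin.≟ dst | tmp Fin.≟ tmp
      ... | yes eq | _ | _ = contradiction (sym eq) src≢tmp
      ... | no _ | yes eq | _ = contradiction (sym eq) dst≢tmp
      ... | no _ | no _ | yes _ = refl
      ... | no _ | no _ | no tmp≢tmp = contradiction refl tmp≢tmp

      out-swept : ∀ j → Swept (out j) x (lookup s j) (middle j)
      out-swept j with j Fin.≟ src | j Fin.≟ dst | j Fin.≟ tmp
      ... | yes refl | _ | _ = sym (ℕ.+-identityʳ x)
      ... | no _ | yes refl | _ = refl
      ... | no _ | no _ | yes refl = trans (sym (ℕ.+-identityʳ x)) (cong (λ k → x + k) (sym tmp≡0))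
      ... | no _ | no _ | no _ = refl

      back-swept : ∀ j → Swept (back j) x (middle j) (lookup (s [ dst ]≔ (x + lookup s dst)) j)
      back-swept j with j Fin.≟ src | j Fin.≟ dst | j Fin.≟ tmp
      ... | yes refl | _ | _ = trans (lookup∘update′ src≢dst s _) (sym (ℕ.+-identityʳ x))
      ... | no _ | yes refl | yes refl = contradiction refl dst≢tmp
      ... | no _ | yes refl | no _ = lookup∘update dst s _
      ... | no _ | no j≢dst | yes refl =
        trans (sym (ℕ.+-identityʳ x)) (cong (λ k → x + k) (sym (trans (lookup∘update′ j≢dst s _) tmp≡0)))
      ... | no _ | no j≢dst | no _ = lookup∘update′ j≢dst s _

-- The program counting homomorphisms

open Addition using (add; run-add)

iterate↓-sum : ∀ g M v → iterate↓ (λ m v → g m + v) M v ≡ sum (List.map g (downFrom M)) + v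
iterate↓-sum g zero v = refl
iterate↓-sum g (suc M) v = trans (iterate↓-sum g M (g M + v)) (swap (sum (List.map g (downFrom M))) (g M) v)
  where
  swap : ∀ a b c → a + (b + c) ≡ b + a + c
  swap = solveℕ-∀

iterate↓-* : ∀ n M v → iterate↓ (λ _ v → n + v) M v ≡ M * n + v
iterate↓-* n zero v = refl
iterate↓-* n (suc M) v = trans (iterate↓-* n M (n + v)) (swap (M * n) n v)
  where
  swap : ∀ a b c → a + (b + c) ≡ b + a + c
  swap = solveℕ-∀

module _ {K : ℕ} where

  -- For the graph in hand, `orderᵗ` holds its order and `offsetᵗ` the position of its first matrix
  -- entry. `countᵗ` collects the current count, `storedᵗ` keeps that of the first graph, and
  -- `flagᵗ` accumulates all differences. `scratchᵗ` and `factorᵗ` serve arithmetic and are 0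
  -- between operations.
  inputᵗ orderᵗ offsetᵗ scratchᵗ factorᵗ countᵗ storedᵗ flagᵗ : Fin (8 + K)
  inputᵗ  = zero
  orderᵗ  = suc zero
  offsetᵗ = suc (suc zero)
  scratchᵗ = suc (suc (suc zero))
  factorᵗ = suc (suc (suc (suc zero)))
  countᵗ  = suc (suc (suc (suc (suc zero))))
  storedᵗ = suc (suc (suc (suc (suc (suc zero)))))
  flagᵗ   = suc (suc (suc (suc (suc (suc (suc zero))))))

  vertexᵗ : Fin K → Fin (8 + K)
  vertexᵗ i = 8 ↑ʳ i

  Edges : Set
  Edges = List (Fin K × Fin K)

  addTo : Fin (8 + K) → Fin (8 + K) → Program (8 + K)
  addTo src dst = add src dst scratchᵗ

  mulAddTo : Fin (8 + K) → Fin (8 + K) → Program (8 + K)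
  mulAddTo src dst = addTo src factorᵗ ⨾ loop factorᵗ (addTo orderᵗ dst)

  -- Row-major addressing: offset + u n + v, summed directly on the input head, which starts at 0.
  seek : Fin K → Fin K → Program (8 + K)
  seek u v = addTo offsetᵗ inputᵗ ⨾ mulAddTo (vertexᵗ u) inputᵗ ⨾ addTo (vertexᵗ v) inputᵗ

  drain : Fin (8 + K) → Program (8 + K)
  drain i = while i unmarked (shift (decrement i))

  -- A head within the word meets its first blank at cell 0, because the word itself contains none.
  rewind : Program (8 + K)
  rewind = while inputᵗ is-just (shift (decrement inputᵗ))

  check : Edges → Program (8 + K)
  check [] = shift (replicate _ stay [ countᵗ ]≔ right)
  check ((u , v) ∷ es) = seek u v ⨾ when inputᵗ isTrue (rewind ⨾ check es) rewind

  -- One loop per vertex of the fixed graph, so every map into the target is visited once. The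
  -- vertex tapes named by `ρ` hold the images chosen so far.
  nest : ∀ k → (Fin k → Fin K) → Edges → Program (8 + K)
  nest zero ρ es = check es
  nest (suc k) ρ es = addTo orderᵗ (vertexᵗ (ρ zero)) ⨾ loop (vertexᵗ (ρ zero)) (nest k (ρ ∘ suc) es)

  -- Called with input head and offset both at the start p of a code and order 0. Sweeping over the
  -- unary order n advances all three, and the last shift carries the offset past the separator, to
  -- n + p + 1.
  enter : Program (8 + K)
  enter = while inputᵗ isTrue (shift (right ∷ right ∷ right ∷ replicate _ stay)) ⨾ rewind
        ⨾ shift (replicate _ stay [ offsetᵗ ]≔ right)

  -- Adding n² to the offset skips the matrix. Head and offset then meet at the start of the next
  -- code with order 0, as `enter` expects.
  leave : Program (8 + K)
  leave = mulAddTo orderᵗ offsetᵗ ⨾ drain orderᵗ ⨾ addTo offsetᵗ inputᵗ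

  store : Program (8 + K)
  store = while countᵗ unmarked (shift (decrement countᵗ [ storedᵗ ]≔ right))

  -- Adds |`countᵗ` - `storedᵗ`| to the flag: the loop cancels units pairwise and records the excess
  -- of `countᵗ`, the final sweep records that of `storedᵗ`.
  compare : Program (8 + K)
  compare = loop countᵗ (when storedᵗ unmarked (shift (decrement storedᵗ)) (shift (replicate _ stay [ flagᵗ ]≔ right)))
          ⨾ while storedᵗ unmarked (shift (decrement storedᵗ [ flagᵗ ]≔ right))

  examine : ∀ k → (Fin k → Fin K) → Edges → Program (8 + K)
  -- Cell 0 is blank, so the code of the first graph begins at position 1.
  examine k ρ es = shift (right ∷ stay ∷ right ∷ replicate _ stay) ⨾ enter ⨾ nest k ρ es ⨾ store
                 ⨾ leave ⨾ enter ⨾ nest k ρ es ⨾ compare ⨾ drain orderᵗ ⨾ drain offsetᵗ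

  heads : (i n o s f a b φ : ℕ) → Vec ℕ K → Vec ℕ (8 + K)
  heads i n o s f a b φ xs = i ∷ n ∷ o ∷ s ∷ f ∷ a ∷ b ∷ φ ∷ xs

-- `X` bounds orders, offsets and head positions in the input; `Y` bounds the homomorphism counts,
-- which have an estimate of their own.
module Cost (X : ℕ) where

  cost-add cost-mul cost-seek cost-rewind cost-enter cost-leave : ℕ
  cost-add    = (X * 2 + 1) + (X * 2 + 1)
  cost-mul    = cost-add + (X * (2 + cost-add) + 1)
  cost-seek   = cost-add + (cost-mul + cost-add)
  cost-rewind = X * 2 + 1
  cost-enter  = cost-rewind + (cost-rewind + 1)
  cost-leave  = cost-mul + (cost-rewind + cost-add)

  cost-check : ℕ → ℕ
  cost-check zero = 1
  cost-check (suc e) = cost-seek + suc (cost-rewind + cost-check e)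

  cost-nest : ℕ → ℕ → ℕ
  cost-nest zero e = cost-check e
  cost-nest (suc k) e = cost-add + (X * (2 + cost-nest k e) + 1)

  cost-examine : ℕ → ℕ → ℕ → ℕ
  cost-examine Y k e = 1 + (cost-enter + (cost-nest k e + ((Y * 2 + 1) + (cost-leave + (cost-enter + (cost-nest k e
    + (((Y * 4 + 1) + (Y * 2 + 1)) + (cost-rewind + cost-rewind))))))))

cell-just : ∀ w {k} → k < length w → is-just (cell (List.map just w) k) ≡ true
cell-just (b ∷ w) {zero} _ = refl
cell-just (b ∷ w) {suc k} (s≤s k<) = cell-just w k<

-- Effect and running time of the subprograms

module Runtime (K : ℕ) (w : List Bool) (X : ℕ) (|w|≤X : length w ≤ X) where
  open Cost X

  c : Contents (8 + K)
  c = contents w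

  counter : ∀ i → lookup c (suc i) ≡ marked
  counter i = lookup-replicate i marked

  run-addTo : ∀ src dst s → suc src ≢ dst → suc src ≢ scratchᵗ → dst ≢ scratchᵗ → lookup s scratchᵗ ≡ 0 →
    lookup s (suc src) ≤ X → Runs c (addTo (suc src) dst) s (s [ dst ]≔ (lookup s (suc src) + lookup s dst)) cost-add
  run-addTo src dst s src≢dst src≢scratch dst≢scratch scratch src≤X =
    weaken c (ℕ.+-mono-≤ bound bound)
      (run-add (suc src) dst scratchᵗ c (counter src) (counter (suc (suc zero))) src≢dst src≢scratch dst≢scratch s scratch)
    where bound = ℕ.+-monoˡ-≤ 1 (ℕ.*-monoˡ-≤ 2 src≤X)

  run-rewind : ∀ {p n o s f a b φ xs} → p ≤ length w →
    Runs c rewind (heads p n o s f a b φ xs) (heads 0 n o s f a b φ xs) cost-rewind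
  run-rewind {p} p≤|w| = weaken c (ℕ.+-monoˡ-≤ 1 (ℕ.*-monoˡ-≤ 2 (ℕ.≤-trans p≤|w| |w|≤X)))
    (run-sweep c (decrement inputᵗ) inputᵗ is-just p (passes p p≤|w|)
      (sym (ℕ.+-identityʳ p) , swept-stay p _))
    where
    passes : ∀ p → p ≤ length w → Passes (inputContent w) is-just left p p
    passes zero _ = refl
    passes (suc p) p<|w| = cell-just w p<|w| , λ { _ refl → passes p (ℕ.<⇒≤ p<|w|) }

  run-drain-order : ∀ {i n o s f a b φ xs} → n ≤ X →
    Runs c (drain orderᵗ) (heads i n o s f a b φ xs) (heads i 0 o s f a b φ xs) cost-rewind
  run-drain-order {n = n} n≤X = weaken c (ℕ.+-monoˡ-≤ 1 (ℕ.*-monoˡ-≤ 2 n≤X))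
    (run-counter-sweep c orderᵗ (counter zero) (decrement orderᵗ) n refl refl
      (refl , sym (ℕ.+-identityʳ n) , swept-stay n _))

  run-drain-offset : ∀ {i n o s f a b φ xs} → o ≤ X →
    Runs c (drain offsetᵗ) (heads i n o s f a b φ xs) (heads i n 0 s f a b φ xs) cost-rewind
  run-drain-offset {o = o} o≤X = weaken c (ℕ.+-monoˡ-≤ 1 (ℕ.*-monoˡ-≤ 2 o≤X))
    (run-counter-sweep c offsetᵗ (counter (suc zero)) (decrement offsetᵗ) o refl refl
      (refl , refl , sym (ℕ.+-identityʳ o) , swept-stay o _))

  loop-bound : ∀ {m b} → m ≤ X → m * (2 + b) + 1 ≤ X * (2 + b) + 1
  loop-bound {b = b} m≤X = ℕ.+-monoˡ-≤ 1 (ℕ.*-monoˡ-≤ (2 + b) m≤X)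

  module _ {n a b φ : ℕ} {xs : Vec ℕ K} (n≤X : n ≤ X) where

    run-accumulate-input : ∀ {o} m i → m ≤ X →
      Runs c (loop factorᵗ (addTo orderᵗ inputᵗ)) (heads i n o 0 m a b φ xs) (heads (m * n + i) n o 0 0 a b φ xs)
        (X * (2 + cost-add) + 1)
    run-accumulate-input {o} m i m≤X = ending-at c (cong (λ j → heads j n o 0 0 a b φ xs) (iterate↓-* n m i))
      (weaken c (loop-bound {m} m≤X)
        (run-loop c factorᵗ (counter (suc (suc (suc zero)))) (λ m i → heads i n o 0 m a b φ xs) (λ _ i → n + i) m
          (λ _ _ → refl) (λ _ _ → refl , refl , refl , refl , refl , refl , refl , refl , allStay xs)
          (λ m i _ → run-addTo zero inputᵗ (heads i n o 0 m a b φ xs) (λ ()) (λ ()) (λ ()) refl n≤X) i))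

    run-accumulate-offset : ∀ {i} m o → m ≤ X →
      Runs c (loop factorᵗ (addTo orderᵗ offsetᵗ)) (heads i n o 0 m a b φ xs) (heads i n (m * n + o) 0 0 a b φ xs)
        (X * (2 + cost-add) + 1)
    run-accumulate-offset {i} m o m≤X = ending-at c (cong (λ j → heads i n j 0 0 a b φ xs) (iterate↓-* n m o))
      (weaken c (loop-bound {m} m≤X)
        (run-loop c factorᵗ (counter (suc (suc (suc zero)))) (λ m o → heads i n o 0 m a b φ xs) (λ _ o → n + o) m
          (λ _ _ → refl) (λ _ _ → refl , refl , refl , refl , refl , refl , refl , refl , allStay xs)
          (λ m o _ → run-addTo zero offsetᵗ (heads i n o 0 m a b φ xs) (λ ()) (λ ()) (λ ()) refl n≤X) o))

  position : ℕ → ℕ → Vec ℕ K → Fin K → Fin K → ℕ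
  position n o xs u v = lookup xs v + (lookup xs u * n + o)

  run-seek : ∀ {n o a b φ} xs u v → n ≤ X → o ≤ X → lookup xs u ≤ X → lookup xs v ≤ X →
    Runs c (seek u v) (heads 0 n o 0 0 a b φ xs) (heads (position n o xs u v) n o 0 0 a b φ xs) cost-seek
  run-seek {n} {o} {a} {b} {φ} xs u v n≤X o≤X u≤X v≤X = run-⨾ c
    (ending-at c (cong (λ j → heads j n o 0 0 a b φ xs) (ℕ.+-identityʳ o))
      (run-addTo (suc zero) inputᵗ (heads 0 n o 0 0 a b φ xs) (λ ()) (λ ()) (λ ()) refl o≤X))
    (run-⨾ c (run-⨾ c
      (ending-at c (cong (λ j → heads o n o 0 j a b φ xs) (ℕ.+-identityʳ (lookup xs u)))
        (run-addTo (7 ↑ʳ u) factorᵗ (heads o n o 0 0 a b φ xs) (λ ()) (λ ()) (λ ()) refl u≤X))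
      (run-accumulate-input n≤X (lookup xs u) o u≤X))
    (run-addTo (7 ↑ʳ v) inputᵗ (heads (lookup xs u * n + o) n o 0 0 a b φ xs) (λ ()) (λ ()) (λ ()) refl v≤X))

  bit : ℕ → Bool
  bit = isTrue ∘ inputContent w

  indicator : Bool → ℕ
  indicator true = 1
  indicator false = 0

  module _ (n o : ℕ) where

    respects : Edges {K} → Vec ℕ K → Bool
    respects [] xs = true
    respects ((u , v) ∷ es) xs = if bit (position n o xs u v) then respects es xs else false

    -- The recursion of `nest` in plain arithmetic; it separates the analysis of the machine from
    -- the identification with `hom`.
    total : Edges {K} → ∀ k → (Fin k → Fin K) → Vec ℕ K → ℕ
    total es zero ρ xs = indicator (respects es xs)
    total es (suc k) ρ xs = sum (List.map (λ m → total es k (ρ ∘ suc) (xs [ ρ zero ]≔ m)) (downFrom n))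

  module _ {n o : ℕ} (n≤X : n ≤ X) (o≤X : o ≤ X)
    (fits : ∀ {x y} → x < n → y < n → y + (x * n + o) ≤ length w) (es : Edges {K}) where

    run-check : ∀ {a b φ} es xs → All (λ (u , v) → lookup xs u < n × lookup xs v < n) es →
      Runs c (check es) (heads 0 n o 0 0 a b φ xs) (heads 0 n o 0 0 (indicator (respects n o es xs) + a) b φ xs)
        (cost-check (length es))
    run-check [] xs [] = run-shift c (refl , refl , refl , refl , refl , refl , refl , refl , allStay xs)
    run-check {a} {b} {φ} ((u , v) ∷ es) xs ((u< , v<) ∷ bounds) = run-⨾ c
      (run-seek xs u v n≤X o≤X (ℕ.≤-trans (ℕ.<⇒≤ u<) n≤X) (ℕ.≤-trans (ℕ.<⇒≤ v<) n≤X)) branch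
      where
      branch : Runs c (when inputᵗ isTrue (rewind ⨾ check es) rewind) (heads (position n o xs u v) n o 0 0 a b φ xs)
        (heads 0 n o 0 0 (indicator (respects n o ((u , v) ∷ es) xs) + a) b φ xs) _
      branch with bit (position n o xs u v) in eq
      ... | true = run-when-true c eq (run-⨾ c (run-rewind (fits u< v<)) (run-check es xs bounds))
      ... | false = weaken c (s≤s (ℕ.m≤m+n cost-rewind _)) (run-when-false c eq (run-rewind (fits u< v<)))

    -- A vertex tape either will still be set by an inner loop or already holds a vertex number; at
    -- the innermost level only the second case is left.
    Bounded : ∀ {k} → (Fin k → Fin K) → Vec ℕ K → Fin K → Set
    Bounded ρ xs i = (∃[ j ] ρ j ≡ i) ⊎ lookup xs i < n

    bounded-suc : ∀ {k} (ρ : Fin (suc k) → Fin K) xs {m i} → m < n → Bounded ρ xs i → Bounded (ρ ∘ suc) (xs [ ρ zero ]≔ m) i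
    bounded-suc ρ xs {m} m<n (inj₁ (zero , refl)) = inj₂ (subst (_< n) (sym (lookup∘update (ρ zero) xs m)) m<n)
    bounded-suc ρ xs m<n (inj₁ (suc j , eq)) = inj₁ (j , eq)
    bounded-suc ρ xs {m} {i} m<n (inj₂ i<n) with i Fin.≟ ρ zero
    ... | yes refl = inj₂ (subst (_< n) (sym (lookup∘update (ρ zero) xs m)) m<n)
    ... | no i≢ = inj₂ (subst (_< n) (sym (lookup∘update′ i≢ xs m)) i<n)

    bounded-zero : ∀ {ρ : Fin 0 → Fin K} {xs i} → Bounded ρ xs i → lookup xs i < n
    bounded-zero (inj₂ i<n) = i<n

    -- Injectivity of `ρ` keeps inner loops from disturbing the counters of outer ones, and tapes
    -- not yet set hold 0, so that adding the order loads exactly n.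
    run-nest : ∀ {a b φ} k ρ xs → Injective _≡_ _≡_ ρ → (∀ j → lookup xs (ρ j) ≡ 0) →
      All (λ (u , v) → Bounded ρ xs u × Bounded ρ xs v) es →
      Runs c (nest k ρ es) (heads 0 n o 0 0 a b φ xs)
        (heads 0 n o 0 0 (total n o es k ρ xs + a) b φ xs) (cost-nest k (length es))
    run-nest zero ρ xs inj unset bounds =
      run-check es xs (All.map (λ (u , v) → bounded-zero {ρ} {xs} u , bounded-zero {ρ} {xs} v) bounds)
    run-nest {a} {b} {φ} (suc k) ρ xs inj unset bounds = run-⨾ c
      (ending-at c (cong (λ j → heads 0 n o 0 0 a b φ (xs [ i ]≔ j))
          (trans (cong (λ k → n + k) (unset zero)) (ℕ.+-identityʳ n)))
        (run-addTo zero (vertexᵗ i) (heads 0 n o 0 0 a b φ xs) (λ ()) (λ ()) (λ ()) refl n≤X))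
      (ending-at c (cong₂ (λ a′ xs′ → heads 0 n o 0 0 a′ b φ xs′)
        (iterate↓-sum (λ m → total n o es k (ρ ∘ suc) (xs [ i ]≔ m)) n a)
          -- The loop ends with its counter at 0, the value that `xs` had there, so the vertex tapes
          -- are restored.
          (trans (cong (xs [ i ]≔_) (sym (unset zero))) ([]≔-lookup xs i)))
        (weaken c (loop-bound n≤X)
          (run-loop c (vertexᵗ i) (counter (7 ↑ʳ i)) (λ m a → heads 0 n o 0 0 a b φ (xs [ i ]≔ m))
            (λ m a → total n o es k (ρ ∘ suc) (xs [ i ]≔ m) + a) n
            (λ m _ → lookup∘update i xs m)
            (λ m _ → refl , refl , refl , refl , refl , refl , refl , refl , decrement-moved xs i m)
            (λ m a m<n → run-nest k (ρ ∘ suc) (xs [ i ]≔ m) (Fin.suc-injective ∘ inj)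
              (λ j → trans (lookup∘update′ (λ eq → Fin.0≢1+n (sym (inj eq))) xs m) (unset (suc j)))
              (All.map (λ (u , v) → bounded-suc ρ xs m<n u , bounded-suc ρ xs m<n v) bounds)) a)))
      where i = ρ zero

  run-enter : ∀ {a b φ xs} p m → Passes (inputContent w) isTrue right m p → m + p ≤ length w →
    Runs c enter (heads p 0 p 0 0 a b φ xs) (heads 0 m (suc (m + p)) 0 0 a b φ xs) cost-enter
  run-enter p m pass m+p≤|w| = run-⨾ c
    (weaken c (ℕ.+-monoˡ-≤ 1 (ℕ.*-monoˡ-≤ 2 (ℕ.≤-trans (ℕ.m≤m+n m p) (ℕ.≤-trans m+p≤|w| |w|≤X))))
      (run-sweep c _ inputᵗ isTrue m pass (refl , sym (ℕ.+-identityʳ m) , refl , swept-stay m _)))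
    (run-⨾ c (run-rewind m+p≤|w|) (run-shift c (refl , refl , refl , allStay _)))

  run-leave : ∀ {n o a b φ xs} → n ≤ X → n * n + o ≤ X →
    Runs c leave (heads 0 n o 0 0 a b φ xs) (heads (n * n + o) 0 (n * n + o) 0 0 a b φ xs) cost-leave
  run-leave {n} {o} {a} {b} {φ} {xs} n≤X n²+o≤X = run-⨾ c
    (run-⨾ c
      (ending-at c (cong (λ j → heads 0 n o 0 j a b φ xs) (ℕ.+-identityʳ n))
        (run-addTo zero factorᵗ (heads 0 n o 0 0 a b φ xs) (λ ()) (λ ()) (λ ()) refl n≤X))
      (run-accumulate-offset n≤X n o n≤X))
    (run-⨾ c (run-drain-order n≤X)
      (ending-at c (cong (λ j → heads j 0 (n * n + o) 0 0 a b φ xs) (ℕ.+-identityʳ (n * n + o)))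
        (run-addTo (suc zero) inputᵗ (heads 0 0 (n * n + o) 0 0 a b φ xs) (λ ()) (λ ()) (λ ()) refl n²+o≤X)))

  run-store : ∀ {n o a φ xs} → Runs c store (heads 0 n o 0 0 a 0 φ xs) (heads 0 n o 0 0 0 a φ xs) (a * 2 + 1)
  run-store {a = a} = run-counter-sweep c countᵗ (counter (suc (suc (suc (suc zero))))) _ a refl refl
    (refl , refl , refl , refl , refl , sym (ℕ.+-identityʳ a) , sym (ℕ.+-identityʳ a) , swept-stay a _)

  match : ℕ × ℕ → ℕ × ℕ
  match (zero , φ) = 0 , suc φ
  match (suc b , φ) = b , φ

  iterate-match : ∀ a b φ → iterate↓ (λ _ → match) a (b , φ) ≡ (b ∸ a , (a ∸ b) + φ)
  iterate-match zero zero φ = refl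
  iterate-match zero (suc b) φ = refl
  iterate-match (suc a) zero φ = trans (iterate-match a 0 (suc φ)) (cong₂ _,_ (ℕ.0∸n≡0 a) (ℕ.+-suc a φ))
  iterate-match (suc a) (suc b) φ = iterate-match a b φ

  run-compare : ∀ {n o a b φ xs Y} → a ≤ Y → b ≤ Y →
    Runs c compare (heads 0 n o 0 0 a b φ xs) (heads 0 n o 0 0 0 0 ((b ∸ a) + ((a ∸ b) + φ)) xs)
      ((Y * 4 + 1) + (Y * 2 + 1))
  run-compare {n} {o} {a} {b} {φ} {xs} {Y} a≤Y b≤Y = run-⨾ c
    (ending-at c (cong (λ (b , φ) → heads 0 n o 0 0 0 b φ xs) (iterate-match a b φ))
      (weaken c (ℕ.+-monoˡ-≤ 1 (ℕ.*-monoˡ-≤ 4 a≤Y))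
        (run-loop c countᵗ (counter (suc (suc (suc (suc zero))))) (λ a (b , φ) → heads 0 n o 0 0 a b φ xs) (λ _ → match) a
          (λ _ _ → refl) (λ _ _ → refl , refl , refl , refl , refl , refl , refl , refl , allStay xs)
          (λ a (b , φ) _ → body a b φ) (b , φ))))
    (weaken c (ℕ.+-monoˡ-≤ 1 (ℕ.*-monoˡ-≤ 2 (ℕ.≤-trans (ℕ.m∸n≤m b a) b≤Y)))
      (run-counter-sweep c storedᵗ stored-counter _ (b ∸ a) refl refl
        (refl , refl , refl , refl , refl , refl , sym (ℕ.+-identityʳ (b ∸ a)) , refl , swept-stay _ _)))
    where
    stored-counter : lookup c storedᵗ ≡ marked
    stored-counter = counter (suc (suc (suc (suc (suc zero)))))

    body : ∀ a b φ → Runs c (when storedᵗ unmarked (shift (decrement storedᵗ)) (shift (replicate _ stay [ flagᵗ ]≔ right)))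
      (heads 0 n o 0 0 a b φ xs) (heads 0 n o 0 0 a (proj₁ (match (b , φ))) (proj₂ (match (b , φ))) xs) 2
    body a zero φ = run-when-false c
      (cong unmarked (test-counter c storedᵗ stored-counter (heads 0 n o 0 0 a 0 φ xs) refl))
      (run-shift c (refl , refl , refl , refl , refl , refl , refl , refl , allStay xs))
    body a (suc b) φ = run-when-true c
      (cong unmarked (test-counter c storedᵗ stored-counter (heads 0 n o 0 0 a (suc b) φ xs) refl))
      (run-shift c (refl , refl , refl , refl , refl , refl , refl , refl , allStay xs))

  -- The code of a graph of order n lies at position p of the input.
  record Located (p n : ℕ) : Set where
    field
      ones      : Passes (inputContent w) isTrue right n p
      separator : n + p ≤ length w
      fits      : ∀ {x y} → x < n → y < n → y + (x * n + suc (n + p)) ≤ length w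

    count : Edges {K} → ∀ k → (Fin k → Fin K) → ℕ
    count es k ρ = total n (suc (n + p)) es k ρ (replicate K 0)

  open Located

  -- The position of `H` has the form in which `leave` computes it, m² beyond the offset of `G`. If
  -- the last graph is empty, its offset lies one past the end of the word; therefore `X` exceeds
  -- the input length.
  run-examine : ∀ {φ m n Y} → suc (length w) ≤ X → (G : Located 1 m) (H : Located (m * m + suc (m + 1)) n) →
    ∀ k ρ es → Injective _≡_ _≡_ ρ → All (λ (u , v) → (∃[ j ] ρ j ≡ u) × (∃[ j ] ρ j ≡ v)) es →
    count G es k ρ ≤ Y → count H es k ρ ≤ Y →
    Runs c (examine k ρ es) (heads 0 0 0 0 0 0 0 φ (replicate K 0))
      (heads 0 0 0 0 0 0 0 ((count G es k ρ ∸ count H es k ρ) + ((count H es k ρ ∸ count G es k ρ) + φ)) (replicate K 0))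
      (cost-examine Y k (length es))
  run-examine {φ} {m} {n} {Y} |w|<X G H k ρ es inj covered G≤Y H≤Y =
    run-⨾ c (run-shift c (refl , refl , refl , allStay _))
    (run-⨾ c (run-enter 1 m (ones G) (separator G))
    (run-⨾ c (run-count G)
    (run-⨾ c (weaken c (ℕ.+-monoˡ-≤ 1 (ℕ.*-monoˡ-≤ 2 G≤Y)) run-store)
    (run-⨾ c (run-leave (order≤X G) (ℕ.≤-trans (ℕ.m+n≤o⇒n≤o n (separator H)) |w|≤X))
    (run-⨾ c (run-enter _ n (ones H) (separator H))
    (run-⨾ c (run-count H)
    (run-⨾ c (run-compare H≤Y G≤Y)
    (run-⨾ c (run-drain-order (order≤X H)) (run-drain-offset (offset≤X H))))))))))
    where
    order≤X : ∀ {p n} → Located p n → n ≤ X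
    order≤X {p} {n} L = ℕ.≤-trans (ℕ.m≤m+n n p) (ℕ.≤-trans (separator L) |w|≤X)

    offset≤X : ∀ {p n} → Located p n → suc (n + p) ≤ X
    offset≤X L = ℕ.≤-trans (s≤s (separator L)) |w|<X

    run-count : ∀ {p n b φ} (L : Located p n) →
      Runs c (nest k ρ es) (heads 0 n (suc (n + p)) 0 0 0 b φ (replicate K 0))
        (heads 0 n (suc (n + p)) 0 0 (count L es k ρ) b φ (replicate K 0)) (cost-nest k (length es))
    run-count {p} {n} {b} {φ} L = ending-at c
      (cong (λ a → heads 0 n (suc (n + p)) 0 0 a b φ (replicate K 0)) (ℕ.+-identityʳ (count L es k ρ)))
      (run-nest (order≤X L) (offset≤X L) (fits L) es k ρ (replicate K 0) inj (λ j → lookup-replicate (ρ j) 0)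
        (All.map (λ (u , v) → inj₁ u , inj₁ v) covered))

-- Graph codes and the correctness of the count

cell-++ʳ : ∀ xs ys k → cell (map just (xs ++ ys)) (length xs + k) ≡ cell (map just ys) k
cell-++ʳ [] ys k = refl
cell-++ʳ (x ∷ xs) ys k = cell-++ʳ xs ys k

cell-++ˡ : ∀ xs ys {k} → k < length xs → cell (map just (xs ++ ys)) k ≡ cell (map just xs) k
cell-++ˡ (x ∷ xs) ys {zero} _ = refl
cell-++ˡ (x ∷ xs) ys {suc k} (s≤s k<) = cell-++ˡ xs ys k<

cell-replicate : ∀ {b n k} → k < n → cell (map just (List.replicate n b)) k ≡ just b
cell-replicate {n = suc n} {zero} _ = refl
cell-replicate {n = suc n} {suc k} (s≤s k<n) = cell-replicate k<n

cell-row : ∀ {A : Set} {n} (h : A → Bool) (g : Fin n → A) v →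
  cell (map just (map h (List.tabulate g))) (toℕ v) ≡ just (h (g v))
cell-row h g zero = refl
cell-row h g (suc v) = cell-row h (g ∘ suc) v

length-rows : ∀ {A : Set} {m n} (f : A → List Bool) (g : Fin m → A) → (∀ x → length (f x) ≡ n) →
  length (concatMap f (List.tabulate g)) ≡ m * n
length-rows {m = zero} f g |f| = refl
length-rows {m = suc m} f g |f| = trans (length-++ (f (g zero))) (cong₂ _+_ (|f| _) (length-rows f (g ∘ suc) |f|))

cell-rows : ∀ {A : Set} {m n} (f : A → List Bool) (g : Fin m → A) → (∀ x → length (f x) ≡ n) →
  ∀ post u {k} → k < n → cell (map just (concatMap f (List.tabulate g) ++ post)) (toℕ u * n + k) ≡
    cell (map just (f (g u))) k
cell-rows f g |f| post zero {k} k<n = trans (cong (λ l → cell (map just l) k) (++-assoc (f (g zero)) _ post))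
  (cell-++ˡ (f (g zero)) _ (subst (k <_) (sym (|f| _)) k<n))
cell-rows {n = n} f g |f| post (suc u) {k} k<n = trans
  (cong₂ (λ l j → cell (map just l) j) (++-assoc (f (g zero)) (concatMap f (List.tabulate (g ∘ suc))) post)
    (trans (ℕ.+-assoc n (toℕ u * n) k) (cong (_+ (toℕ u * n + k)) (sym (|f| (g zero))))))
  (trans (cell-++ʳ (f (g zero)) _ (toℕ u * n + k)) (cell-rows f (g ∘ suc) |f| post u k<n))

matrix : Graph → List Bool
matrix G = concatMap (λ u → map (adj G u) (allFin (order G))) (allFin (order G))

length-row : ∀ G u → length (map (adj G u) (allFin (order G))) ≡ order G
length-row G u = trans (length-map (adj G u) (allFin (order G))) (length-tabulate id)

length-matrix : ∀ G → length (matrix G) ≡ order G * order G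
length-matrix G = length-rows _ id (length-row G)

length-encode : ∀ G → length (encode G) ≡ order G + suc (order G * order G)
length-encode G = trans (length-++ (List.replicate (order G) true))
  (cong₂ (λ a b → a + suc b) (length-replicate (order G)) (length-matrix G))

passes-right : ∀ {f} n p → (∀ {k} → k < n → isTrue (f (k + p)) ≡ true) → isTrue (f (n + p)) ≡ false →
  Passes f isTrue right n p
passes-right zero p _ stop = stop
passes-right {f} (suc n) p go stop = go (s≤s z≤n) , λ { _ refl → passes-right n (suc p)
  (λ {k} k<n → subst (λ j → isTrue (f j) ≡ true) (sym (ℕ.+-suc k p)) (go (s≤s k<n)))
  (subst (λ j → isTrue (f j) ≡ false) (sym (ℕ.+-suc n p)) stop) }

module Encoded (pre post : List Bool) (G : Graph) where

  private
    n p : ℕ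
    n = order G
    w = pre ++ encode G ++ post
    p = suc (length pre)

    content : ∀ k → inputContent w (k + p) ≡ cell (map just (encode G ++ post)) k
    content k = trans (cong (inputContent w) (trans (ℕ.+-suc k (length pre)) (cong suc (ℕ.+-comm k (length pre)))))
      (cell-++ʳ pre (encode G ++ post) k)

    split : encode G ++ post ≡ List.replicate n true ++ false ∷ (matrix G ++ post)
    split = ++-assoc (List.replicate n true) _ post

    after-ones : ∀ k → inputContent w (n + k + p) ≡ cell (map just (false ∷ (matrix G ++ post))) k
    after-ones k = trans (content (n + k)) (trans
      (cong₂ (λ l j → cell (map just l) (j + k)) split (sym (length-replicate n)))
      (cell-++ʳ (List.replicate n true) _ k))

    length-w : length w ≡ length pre + (n + suc (n * n) + length post)
    length-w = trans (length-++ pre) (cong (λ k → length pre + k)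
      (trans (length-++ (encode G)) (cong (_+ length post) (length-encode G))))

  bits : ∀ u v → isTrue (inputContent w (toℕ v + (toℕ u * n + suc (n + p)))) ≡ adj G u v
  bits u v = trans (cong (isTrue ∘ inputContent w) (rearrange (toℕ v) (toℕ u * n) n p))
    (cong isTrue (trans (after-ones (suc (toℕ u * n + toℕ v)))
      (trans (cell-rows _ id (length-row G) post u (toℕ<n v)) (cell-row (adj G u) id v))))
    where
    rearrange : ∀ v un n p → v + (un + suc (n + p)) ≡ n + suc (un + v) + p
    rearrange = solveℕ-∀

  located : ∀ K X |w|≤X → Runtime.Located K w X |w|≤X p n
  located K X |w|≤X = record
    { ones = passes-right n p
        (λ {k} k<n → cong isTrue (trans (content k) (trans (cong (λ l → cell (map just l) k) split)
          (trans (cell-++ˡ (List.replicate n true) _ (subst (k <_) (sym (length-replicate n)) k<n)) (cell-replicate k<n)))))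
        (cong isTrue (trans (cong (λ j → inputContent w (j + p)) (sym (ℕ.+-identityʳ n))) (after-ones 0)))
    ; separator = subst (n + p ≤_) (sym length-w) (ℕ.≤-trans (ℕ.≤-reflexive (ℕ.+-comm n p))
        (ℕ.≤-trans (ℕ.≤-reflexive (sym (ℕ.+-suc (length pre) n)))
        (ℕ.+-monoʳ-≤ (length pre) (ℕ.≤-trans (ℕ.≤-trans (s≤s (ℕ.m≤m+n n (n * n))) (ℕ.≤-reflexive (sym (ℕ.+-suc n (n * n)))))
          (ℕ.m≤m+n _ (length post))))))
    ; fits = λ {x} {y} x<n y<n → subst (y + (x * n + suc (n + p)) ≤_) (sym length-w) (begin
        y + (x * n + suc (n + p))                        ≡⟨ rearrange y (x * n) n (length pre) ⟩
        length pre + (n + suc (suc y + x * n))           ≤⟨ ℕ.+-monoʳ-≤ (length pre) (ℕ.+-monoʳ-≤ n (s≤s (entry-bound x<n y<n))) ⟩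
        length pre + (n + suc (n * n))                   ≤⟨ ℕ.+-monoʳ-≤ (length pre) (ℕ.m≤m+n _ (length post)) ⟩
        length pre + (n + suc (n * n) + length post)     ∎) }
    where
    open ℕ.≤-Reasoning
    rearrange : ∀ y xn n l → y + (xn + suc (n + suc l)) ≡ l + (n + suc (suc y + xn))
    rearrange = solveℕ-∀
    entry-bound : ∀ {x y} → x < n → y < n → suc y + x * n ≤ n * n
    entry-bound {x} x<n y<n = ℕ.≤-trans (ℕ.+-monoˡ-≤ (x * n) y<n) (ℕ.*-monoˡ-≤ n x<n)

-- Lists `Fin n` in the descending order of the loops, so that the sums in `total` match term by
-- term.
finDown : ∀ n → List (Fin n)
finDown zero = []
finDown (suc n) = fromℕ n ∷ map inject₁ (finDown n)

map-toℕ-finDown : ∀ n → map toℕ (finDown n) ≡ downFrom n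
map-toℕ-finDown zero = refl
map-toℕ-finDown (suc n) = cong₂ _∷_ (toℕ-fromℕ n)
  (trans (sym (map-∘ (finDown n))) (trans (map-cong toℕ-inject₁ (finDown n)) (map-toℕ-finDown n)))

finDown-unique : ∀ n → Unique (finDown n)
finDown-unique n = Unique.map⁻ (subst Unique (sym (map-toℕ-finDown n)) (downFrom⁺ n))

∈-finDown : ∀ {n} (x : Fin n) → x ∈ finDown n
∈-finDown {n} x with ∈-map⁻ toℕ (subst (toℕ x ∈_) (sym (map-toℕ-finDown n)) (∈-downFrom⁺ (toℕ<n x)))
... | y , y∈ , eq rewrite toℕ-injective eq = y∈

allVecs-unique : ∀ {X : Set} {xs : List X} → Unique xs → ∀ k → Unique (allVecs xs k)
allVecs-unique u zero = [] ∷ []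
allVecs-unique u (suc k) = cartesianProductWith⁺ _∷_ ∷-injective u (allVecs-unique u k)

-- Counting one coordinate at a time; this merges the nested sums of `total` into a single count of
-- vectors.
length-filter-product : ∀ {X Y Z : Set} (f : X → Y → Z) (P : Z → Bool) xs ys →
  length (filter (λ z → P z ≟ᵇ true) (cartesianProductWith f xs ys)) ≡
  sum (map (λ x → length (filter (λ y → P (f x y) ≟ᵇ true) ys)) xs)
length-filter-product f P [] ys = refl
length-filter-product f P (x ∷ xs) ys =
  trans (cong length (filter-++ (λ z → P z ≟ᵇ true) (map (f x) ys) _))
    (trans (length-++ (filter (λ z → P z ≟ᵇ true) (map (f x) ys)))
      (cong₂ _+_ (go ys) (length-filter-product f P xs ys)))
  where
  go : ∀ ys → length (filter (λ z → P z ≟ᵇ true) (map (f x) ys)) ≡ length (filter (λ y → P (f x y) ≟ᵇ true) ys)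
  go [] = refl
  go (y ∷ ys) with P (f x y)
  ... | true = cong suc (go ys)
  ... | false = go ys

assign : ∀ {K k} → (Fin k → Fin K) → Vec ℕ k → Vec ℕ K → Vec ℕ K
assign ρ [] xs = xs
assign ρ (m ∷ v) xs = assign (ρ ∘ suc) v (xs [ ρ zero ]≔ m)

assign-other : ∀ {K k} (ρ : Fin k → Fin K) v xs {i} → (∀ j → i ≢ ρ j) → lookup (assign ρ v xs) i ≡ lookup xs i
assign-other ρ [] xs i∉ = refl
assign-other ρ (m ∷ v) xs i∉ = trans (assign-other (ρ ∘ suc) v _ (i∉ ∘ suc)) (lookup∘update′ (i∉ zero) xs m)

lookup-assign : ∀ {K k} (ρ : Fin k → Fin K) → Injective _≡_ _≡_ ρ → ∀ v xs u → lookup (assign ρ v xs) (ρ u) ≡ lookup v u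
lookup-assign ρ inj (m ∷ v) xs zero =
  trans (assign-other (ρ ∘ suc) v _ (λ j eq → Fin.0≢1+n (inj eq))) (lookup∘update (ρ zero) xs m)
lookup-assign ρ inj (m ∷ v) xs (suc u) = lookup-assign (ρ ∘ suc) (Fin.suc-injective ∘ inj) v _ u

edges : (F : Graph) → List (Vertex F × Vertex F)
edges F = filter (λ (u , v) → adj F u v ≟ᵇ true) (cartesianProduct (allFin (order F)) (allFin (order F)))

∈-edges : ∀ F {u v} → Adj F u v → (u , v) ∈ edges F
∈-edges F uv = ∈-filter⁺ (λ (u , v) → adj F u v ≟ᵇ true) (∈-cartesianProduct⁺ (∈-allFin _) (∈-allFin _)) uv

edges-adj : ∀ F {e} → e ∈ edges F → Adj F (proj₁ e) (proj₂ e)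
edges-adj F e∈ = proj₂ (∈-filter⁻ (λ (u , v) → adj F u v ≟ᵇ true)
  {xs = cartesianProduct (allFin (order F)) (allFin (order F))} e∈)

-- All graphs of the list share the same `K` vertex tapes; each uses the first `order F` of them.
module Placement {K : ℕ} (F : Graph) (|F|≤K : order F ≤ K) where

  ρ : Vertex F → Fin K
  ρ u = inject≤ u |F|≤K

  ρ-injective : Injective _≡_ _≡_ ρ
  ρ-injective = inject≤-injective |F|≤K |F|≤K _ _

  es : Edges {K}
  es = map (Product.map ρ ρ) (edges F)

  covered : All (λ (u , v) → (∃[ j ] ρ j ≡ u) × (∃[ j ] ρ j ≡ v)) es
  covered = All.map⁺ (All.universal (λ (u , v) → (u , refl) , (v , refl)) (edges F))

module Counts (K : ℕ) (w : List Bool) (X : ℕ) (|w|≤X : length w ≤ X)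
  (F G : Graph) (o : ℕ) (|F|≤K : order F ≤ K) where
  open Runtime K w X |w|≤X
  open Placement F |F|≤K

  private
    n = order G
    k = order F

  total-as-length : ∀ es {k} (ρ : Fin k → Fin K) xs → total n o es k ρ xs ≡
    length (filter (λ v → respects n o es (assign ρ (Vec.map toℕ v) xs) ≟ᵇ true) (allVecs (finDown n) k))
  total-as-length es {zero} ρ xs with respects n o es xs
  ... | true = refl
  ... | false = refl
  total-as-length es {suc k} ρ xs = begin
    sum (map value (downFrom n))               ≡⟨ cong (sum ∘ map value) (map-toℕ-finDown n) ⟨
    sum (map value (map toℕ (finDown n)))      ≡⟨ cong sum (map-∘ (finDown n)) ⟨
    sum (map (value ∘ toℕ) (finDown n))
      ≡⟨ cong sum (map-cong (λ x → total-as-length es (ρ ∘ suc) (xs [ ρ zero ]≔ toℕ x)) (finDown n)) ⟩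
    _ ≡⟨ length-filter-product _∷_ (λ v → respects n o es (assign ρ (Vec.map toℕ v) xs))
           (finDown n) (allVecs (finDown n) k) ⟨
    _ ∎
    where
    open ≡-Reasoning
    value : ℕ → ℕ
    value m = total n o es k (ρ ∘ suc) (xs [ ρ zero ]≔ m)

  module _ (bits : ∀ u v → bit (toℕ v + (toℕ u * n + o)) ≡ adj G u v) where

    respects⁻ : ∀ es xs → respects n o es xs ≡ true → All (λ (u , v) → bit (position n o xs u v) ≡ true) es
    respects⁻ [] xs _ = []
    respects⁻ ((u , v) ∷ es) xs eq with bit (position n o xs u v) in b
    ... | true = b ∷ respects⁻ es xs eq

    respects⁺ : ∀ es xs → All (λ (u , v) → bit (position n o xs u v) ≡ true) es → respects n o es xs ≡ true
    respects⁺ [] xs [] = refl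
    respects⁺ ((u , v) ∷ es) xs (b ∷ bs) rewrite b = respects⁺ es xs bs

    private
      zeros = replicate K 0

      position-bit : ∀ (f : Vec (Fin n) k) u v →
        bit (position n o (assign ρ (Vec.map toℕ f) zeros) (ρ u) (ρ v)) ≡ adj G (lookup f u) (lookup f v)
      position-bit f u v = trans (cong₂ (λ x y → bit (y + (x * n + o))) (value u) (value v)) (bits _ _)
        where
        value : ∀ u → lookup (assign ρ (Vec.map toℕ f) zeros) (ρ u) ≡ toℕ (lookup f u)
        value u = trans (lookup-assign ρ ρ-injective (Vec.map toℕ f) zeros u) (lookup-map u toℕ f)

      respects? : ∀ (f : Vec (Fin n) k) → Dec (respects n o es (assign ρ (Vec.map toℕ f) zeros) ≡ true)
      respects? f = respects n o es (assign ρ (Vec.map toℕ f) zeros) ≟ᵇ true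

      respects-hom : ∀ f → respects n o es (assign ρ (Vec.map toℕ f) zeros) ≡ true → IsHom F G (lookup f)
      respects-hom f eq u v uv = trans (sym (position-bit f u v))
        (All.lookup (All.map⁻ (respects⁻ es _ eq)) (∈-edges F uv))

      hom-respects : ∀ f → IsHom F G (lookup f) → respects n o es (assign ρ (Vec.map toℕ f) zeros) ≡ true
      hom-respects f f-hom = respects⁺ es _ (All.map⁺ (All.tabulate λ {(u , v)} e∈ →
        trans (position-bit f u v) (f-hom u v (edges-adj F e∈))))

      vecs = allVecs (finDown n) k

    -- The list `allVecs` contains every vector of images exactly once, and those that respect `es`
    -- are the homomorphisms, by the correspondence between matrix bits and adjacency.
    total≡hom : total n o es k ρ zeros ≡ hom F G
    total≡hom = trans (total-as-length es ρ zeros) (ℕ.≤-antisym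
      (length≤hom F G (Unique.filter⁺ respects? (allVecs-unique (finDown-unique n) k)) lookup
        (λ {f} f∈ → respects-hom f (proj₂ (∈-filter⁻ respects? {xs = vecs} f∈)))
        (λ {f} {g} _ _ eq → trans (sym (Vec.tabulate∘lookup f)) (trans (Vec.tabulate-cong eq) (Vec.tabulate∘lookup g))))
      (hom≤length F G {ys = filter respects? vecs} tabulate
        (λ {f} f-hom → ∈-filter⁺ respects? (∈-allVecs ∈-finDown _)
          (hom-respects (tabulate f) (IsHom-resp-≗ F G (sym ∘ lookup∘tabulate f) f-hom)))
        (λ {f} {g} eq u → trans (sym (lookup∘tabulate f u)) (trans (cong (λ v → lookup v u) eq) (lookup∘tabulate g u)))))

-- The counts themselves are written in unary, and for a fixed `F` this bound is polynomial in the
-- order of `G`.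
hom-bound : ∀ F G → hom F G ≤ order G ^ order F
hom-bound F G = ℕ.≤-trans (length-filter _ (allFin (order G ^ order F))) (ℕ.≤-reflexive (length-tabulate id))

record CodeAt (w : List Bool) (p : ℕ) (G : Graph) : Set where
  field
    codeLocated : ∀ K X |w|≤X → Runtime.Located K w X |w|≤X p (order G)
    codeBits    : ∀ u v → isTrue (inputContent w (toℕ v + (toℕ u * order G + suc (order G + p)))) ≡ adj G u v

code-at : ∀ pre post G {w p} → pre ++ encode G ++ post ≡ w → suc (length pre) ≡ p → CodeAt w p G
code-at pre post G refl refl = record { codeLocated = located ; codeBits = bits }
  where open Encoded pre post G

-- Polynomial time

-- Evaluation is exact rather than an upper bound, so the fuel can be rewritten into the cost that
-- the run is known to meet.
Polynomial : (ℕ → ℕ) → Set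
Polynomial f = Σ[ p ∈ List ℕ ] (∀ x → evalPoly p x ≡ f x)

infixl 6 _⊕_
infixl 7 _⊗_

addPoly : List ℕ → List ℕ → List ℕ
addPoly [] q = q
addPoly (a ∷ p) [] = a ∷ p
addPoly (a ∷ p) (b ∷ q) = a + b ∷ addPoly p q

evalPoly-add : ∀ p q x → evalPoly (addPoly p q) x ≡ evalPoly p x + evalPoly q x
evalPoly-add [] q x = refl
evalPoly-add (a ∷ p) [] x = sym (ℕ.+-identityʳ _)
evalPoly-add (a ∷ p) (b ∷ q) x = trans (cong (λ r → a + b + x * r) (evalPoly-add p q x))
  (regroup a b x (evalPoly p x) (evalPoly q x))
  where
  regroup : ∀ a b x p q → a + b + x * (p + q) ≡ a + x * p + (b + x * q)
  regroup = solveℕ-∀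

evalPoly-scale : ∀ a p x → evalPoly (map (a *_) p) x ≡ a * evalPoly p x
evalPoly-scale a [] x = sym (ℕ.*-zeroʳ a)
evalPoly-scale a (b ∷ p) x = trans (cong (λ r → a * b + x * r) (evalPoly-scale a p x)) (regroup a b x (evalPoly p x))
  where
  regroup : ∀ a b x p → a * b + x * (a * p) ≡ a * (b + x * p)
  regroup = solveℕ-∀

mulPoly : List ℕ → List ℕ → List ℕ
mulPoly [] q = []
mulPoly (a ∷ p) q = addPoly (map (a *_) q) (0 ∷ mulPoly p q)

evalPoly-mul : ∀ p q x → evalPoly (mulPoly p q) x ≡ evalPoly p x * evalPoly q x
evalPoly-mul [] q x = refl
evalPoly-mul (a ∷ p) q x = trans (evalPoly-add (map (a *_) q) (0 ∷ mulPoly p q) x)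
  (trans (cong₂ (λ r s → r + x * s) (evalPoly-scale a q x) (evalPoly-mul p q x))
    (regroup a x (evalPoly p x) (evalPoly q x)))
  where
  regroup : ∀ a x p q → a * q + x * (p * q) ≡ (a + x * p) * q
  regroup = solveℕ-∀

constant : ∀ a → Polynomial (λ _ → a)
constant a = a ∷ [] , λ x → trans (cong (λ k → a + k) (ℕ.*-zeroʳ x)) (ℕ.+-identityʳ a)

_⊕_ : ∀ {f g} → Polynomial f → Polynomial g → Polynomial (λ x → f x + g x)
(p , eqp) ⊕ (q , eqq) = addPoly p q , λ x → trans (evalPoly-add p q x) (cong₂ _+_ (eqp x) (eqq x))

_⊗_ : ∀ {f g} → Polynomial f → Polynomial g → Polynomial (λ x → f x * g x)
(p , eqp) ⊗ (q , eqq) = mulPoly p q , λ x → trans (evalPoly-mul p q x) (cong₂ _*_ (eqp x) (eqq x))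

successor : Polynomial suc
successor = 1 ∷ 1 ∷ [] , λ x → cong suc (simplify x)
  where
  simplify : ∀ x → x * (1 + x * 0) ≡ x
  simplify = solveℕ-∀

power : ∀ {f} → Polynomial f → ∀ k → Polynomial (λ x → f x ^ k)
power P zero = constant 1
power P (suc k) = P ⊗ power P k

module _ {K : ℕ} where

  examineAll : ∀ Fs → All (λ F → order F ≤ K) Fs → Program (8 + K)
  examineAll [] [] = shift (replicate _ stay)
  examineAll (F ∷ Fs) (|F|≤K ∷ |Fs|≤K) = examine (order F) ρ es ⨾ examineAll Fs |Fs|≤K
    where open Placement F |F|≤K

  cost-examineAll : ℕ → ∀ Fs → All (λ F → order F ≤ K) Fs → ℕ
  cost-examineAll X [] [] = 1
  cost-examineAll X (F ∷ Fs) (|F|≤K ∷ |Fs|≤K) =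
    Cost.cost-examine X (X ^ order F) (order F) (length (Placement.es F |F|≤K)) + cost-examineAll X Fs |Fs|≤K

  -- The argument `suc x` reflects the choice of `X` as one more than the input length. The
  -- combinators copy the cost expressions summand by summand; their recursions run over the order
  -- and the edge list of `F`, which do not grow with x.
  cost-polynomial : ∀ Fs |Fs|≤K → Polynomial (λ x → cost-examineAll (suc x) Fs |Fs|≤K)
  cost-polynomial [] [] = constant 1
  cost-polynomial (F ∷ Fs) (|F|≤K ∷ |Fs|≤K) =
    constant 1 ⊕ (enter′ ⊕ (nest′ (order F) ⊕ ((Y ⊗ constant 2 ⊕ constant 1) ⊕ (leave′ ⊕ (enter′ ⊕ (nest′ (order F)
      ⊕ (((Y ⊗ constant 4 ⊕ constant 1) ⊕ (Y ⊗ constant 2 ⊕ constant 1)) ⊕ (rewind′ ⊕ rewind′))))))))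
    ⊕ cost-polynomial Fs |Fs|≤K
    where
    open module C x = Cost (suc x)
    Y : Polynomial (λ x → suc x ^ order F)
    Y = power successor (order F)
    rewind′ : Polynomial (λ x → cost-rewind x)
    rewind′ = successor ⊗ constant 2 ⊕ constant 1
    add′ : Polynomial (λ x → cost-add x)
    add′ = rewind′ ⊕ rewind′
    mul′ : Polynomial (λ x → cost-mul x)
    mul′ = add′ ⊕ (successor ⊗ (constant 2 ⊕ add′) ⊕ constant 1)
    enter′ : Polynomial (λ x → cost-enter x)
    enter′ = rewind′ ⊕ (rewind′ ⊕ constant 1)
    leave′ : Polynomial (λ x → cost-leave x)
    leave′ = mul′ ⊕ (rewind′ ⊕ add′)
    check′ : ∀ e → Polynomial (λ x → cost-check x e)
    check′ zero = constant 1
    check′ (suc e) = (add′ ⊕ (mul′ ⊕ add′)) ⊕ (constant 1 ⊕ (rewind′ ⊕ check′ e))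
    nest′ : ∀ k → Polynomial (λ x → cost-nest x k (length (Placement.es F |F|≤K)))
    nest′ zero = check′ (length (Placement.es F |F|≤K))
    nest′ (suc k) = add′ ⊕ (successor ⊗ (constant 2 ⊕ nest′ k) ⊕ constant 1)

-- Deciding agreement by accumulated differences

module _ (G H : Graph) where

  -- The two truncated differences add up to |hom F G − hom F H|.
  mismatch : List Graph → ℕ → ℕ
  mismatch [] φ = φ
  mismatch (F ∷ Fs) φ = mismatch Fs ((hom F G ∸ hom F H) + ((hom F H ∸ hom F G) + φ))

  mismatch-equal : ∀ Fs → G ≡[ _∈ Fs ] H → mismatch Fs 0 ≡ 0
  mismatch-equal [] _ = refl
  mismatch-equal (F ∷ Fs) G≡H rewrite G≡H {F} (here refl) | ℕ.n∸n≡0 (hom F H) =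
    mismatch-equal Fs λ {F′} F′∈ → G≡H {F′} (there F′∈)

  -- Later graphs only add to the accumulated value, so a zero at the end forces zeros throughout.
  mismatch-start : ∀ Fs φ → mismatch Fs φ ≡ 0 → φ ≡ 0
  mismatch-start [] φ eq = eq
  mismatch-start (F ∷ Fs) φ eq = ℕ.m+n≡0⇒n≡0 (hom F H ∸ hom F G)
    (ℕ.m+n≡0⇒n≡0 (hom F G ∸ hom F H) (mismatch-start Fs _ eq))

  mismatch-zero : ∀ Fs φ → mismatch Fs φ ≡ 0 → G ≡[ _∈ Fs ] H
  mismatch-zero (F ∷ Fs) φ eq (here refl) = ℕ.≤-antisym
    (ℕ.m∸n≡0⇒m≤n (ℕ.m+n≡0⇒m≡0 (hom F G ∸ hom F H) start))
    (ℕ.m∸n≡0⇒m≤n (ℕ.m+n≡0⇒m≡0 (hom F H ∸ hom F G) (ℕ.m+n≡0⇒n≡0 (hom F G ∸ hom F H) start)))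
    where start = mismatch-start Fs _ eq
  mismatch-zero (F ∷ Fs) φ eq {F′} (there F′∈) = mismatch-zero Fs _ eq {F′} F′∈

  private
    w = encodePair G H
    X : ℕ
    X = suc (length w)
    |w|≤X : length w ≤ X
    |w|≤X = ℕ.n≤1+n (length w)

    G-code : CodeAt w 1 G
    G-code = code-at [] (encode H) G refl refl

    H-code : CodeAt w (order G * order G + suc (order G + 1)) H
    H-code = code-at (encode G) [] H (cong (encode G ++_) (++-identityʳ (encode H)))
      (trans (cong suc (length-encode G)) (rearrange (order G) (order G * order G)))
      where
      rearrange : ∀ m mm → suc (m + suc mm) ≡ mm + suc (m + 1)
      rearrange = solveℕ-∀

  module _ {K : ℕ} where
    open Runtime K w X |w|≤X
    open Located using (count)

    code-order≤X : ∀ {p G} → CodeAt w p G → order G ≤ X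
    code-order≤X {p} {G} code = ℕ.≤-trans (ℕ.m≤m+n (order G) p) (ℕ.≤-trans
      (Located.separator (CodeAt.codeLocated code K X |w|≤X)) |w|≤X)

    count≡hom : ∀ {p G} (code : CodeAt w p G) F |F|≤K →
      count (CodeAt.codeLocated code K X |w|≤X) (Placement.es F |F|≤K) (order F) (Placement.ρ F |F|≤K) ≡ hom F G
    count≡hom {p} {G} code F |F|≤K =
      Counts.total≡hom K w X |w|≤X F G (suc (order G + p)) |F|≤K (CodeAt.codeBits code)

    count-bound : ∀ {p G} (code : CodeAt w p G) F |F|≤K →
      count (CodeAt.codeLocated code K X |w|≤X) (Placement.es F |F|≤K) (order F) (Placement.ρ F |F|≤K) ≤ X ^ order F
    count-bound {G = G} code F |F|≤K = ℕ.≤-trans (ℕ.≤-reflexive (count≡hom code F |F|≤K))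
      (ℕ.≤-trans (hom-bound F G) (ℕ.^-monoˡ-≤ (order F) (code-order≤X code)))

    run-examineAll : ∀ Fs |Fs|≤K φ → Runs c (examineAll Fs |Fs|≤K) (heads 0 0 0 0 0 0 0 φ (replicate K 0))
      (heads 0 0 0 0 0 0 0 (mismatch Fs φ) (replicate K 0)) (cost-examineAll X Fs |Fs|≤K)
    run-examineAll [] [] φ = run-shift c (allStay _)
    run-examineAll (F ∷ Fs) (|F|≤K ∷ |Fs|≤K) φ = run-⨾ c
      (ending-at c (cong₂ (λ g h → heads 0 0 0 0 0 0 0 ((g ∸ h) + ((h ∸ g) + φ)) (replicate K 0))
          (count≡hom G-code F |F|≤K) (count≡hom H-code F |F|≤K))
        (run-examine ℕ.≤-refl (CodeAt.codeLocated G-code K X |w|≤X) (CodeAt.codeLocated H-code K X |w|≤X)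
          (order F) ρ es ρ-injective covered (count-bound G-code F |F|≤K) (count-bound H-code F |F|≤K)))
      (run-examineAll Fs |Fs|≤K _)
      where open Placement F |F|≤K

-- The sum of the orders is a common bound, and it serves as the number `K` of vertex tapes.
order≤sum : ∀ Fs → All (λ F → order F ≤ sum (map order Fs)) Fs
order≤sum [] = []
order≤sum (F ∷ Fs) = ℕ.m≤m+n (order F) _ ∷ All.map (λ |F′|≤ → ℕ.≤-trans |F′|≤ (ℕ.m≤n+m _ (order F))) (order≤sum Fs)

decide-finite : ∀ Fs → PolyTimeDecidable (λ G H → G ≡[ _∈ Fs ] H)
decide-finite Fs = machine program flagᵗ , proj₁ polynomial , λ G H →
  let w = encodePair G H in
  -- The verdict is the symbol under the head of `flagᵗ`, which is the mark precisely when the total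
  -- mismatch is 0.
  isTrue (marked (mismatch G H Fs 0)) ,
  trans (cong (λ t → runWithin (machine program flagᵗ) t (initial (machine program flagᵗ) w))
      (proj₂ polynomial (length w)))
    (machine-run program flagᵗ w (run-examineAll G H Fs (order≤sum Fs) 0)) ,
  verdict-correct G H
  where
  program = examineAll Fs (order≤sum Fs)
  polynomial = constant 3 ⊕ cost-polynomial Fs (order≤sum Fs)

  verdict-correct : ∀ G H → Reflects (G ≡[ _∈ Fs ] H) (isTrue (marked (mismatch G H Fs 0)))
  verdict-correct G H with mismatch G H Fs 0 in eq
  ... | zero = ofʸ (λ {F} → mismatch-zero G H Fs 0 eq {F})
  ... | suc _ = ofⁿ (λ G≡H → contradiction (trans (sym eq) (mismatch-equal G H Fs (λ {F} → G≡H {F}))) λ ())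

decidable-⇔ : ∀ {a b} {R : Graph → Graph → Set a} {S : Graph → Graph → Set b} → (∀ G H → R G H ⇔ S G H) →
  PolyTimeDecidable S → PolyTimeDecidable R
decidable-⇔ R⇔S (M , p , decides) = M , p , λ G H →
  let b , halts , correct = decides G H in b , halts , transfer (R⇔S G H) correct
  where
  transfer : ∀ {a b} {A : Set a} {B : Set b} {v} → A ⇔ B → Reflects B v → Reflects A v
  transfer A⇔B (ofʸ y) = ofʸ (Equivalence.from A⇔B y)
  transfer A⇔B (ofⁿ ¬y) = ofⁿ (¬y ∘ Equivalence.to A⇔B)

theorem35 : ∀ {ℓ} → ExcludedMiddle ℓ →
    (𝓕 : Pred Graph ℓ) → (∀ {F} → 𝓕 F → Simple F) → EssentiallyFinite 𝓕 →
    (Σ[ 𝓕′ ∈ Pred Graph 0ℓ ] Finite 𝓕′ × (∀ G H → G ≡[ 𝓕 ] H ⇔ G ≡[ 𝓕′ ] H))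
    × PolyTimeDecidable (λ G H → G ≡[ 𝓕 ] H)
theorem35 em 𝓕 _ finite with finite-subclass em 𝓕 finite
... | Fs , equivalent = ((_∈ Fs) , (Fs , self) , equivalent) ,
  decidable-⇔ equivalent (decide-finite Fs)
  where
  self : ∀ {C} → C ∈ Fs → Any (C ≅_) Fs
  self {C} = Any.map λ { refl → ≅-refl {C} }
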